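{- For all $n > 0$, $n - 1 \leq \mathcal{G}(K_n, P_5) \leq n + 2$.
   Context: $P_5$ denotes the path on 5 vertices. For a family $\mathcal{F}$ of graphs, a graph is $\mathcal{F}$-free if it contains no member of $\mathcal{F}$ as a subgraph; a subgraph $G \subseteq H$ is $\mathcal{F}$-saturated in $H$ if it is a maximal $\mathcal{F}$-free subgraph of $H$. The $\mathcal{F}$-saturation game $\mathcal{G}(H;\mathcal{F})$: two players, Prolonger and Shortener, alternately add to a graph on $V(H)$, starting from the empty graph, one edge of $H$ not yet present such that the graph remains $\mathcal{F}$-free; the game ends when the graph is $\mathcal{F}$-saturated in $H$. Prolonger aims to maximise and Shortener to minimise the number of edges added; $\mathcal{G}(H;\mathcal{F})$ also denotes this number under optimal play by both players (the game saturation number). The bounds hold regardless of which player moves first. $\mathcal{G}(K_n, P_5)$ means $H = K_n$, $\mathcal{F} = \{P_5\}$. -}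

module Defs where

open import Data.Nat using (ℕ; zero; suc)
open import Data.Fin using (Fin)
open import Data.List using (List; []; _∷_)
open import Data.List.Membership.Propositional using (_∈_)
open import Data.Product using (_×_; _,_; Σ; ∃)
open import Data.Sum using (_⊎_)
open import Relation.Binary.PropositionalEquality using (_≡_; _≢_)
open import Relation.Nullary using (¬_)

-- A (simple) graph on vertex set V(K_n) = Fin n, given by a list of edges.
-- The pair (u , v) in the list stands for the undirected edge uv.
Graph : ℕ → Set
Graph n = List (Fin n × Fin n)

Adj : ∀ {n} → Graph n → Fin n → Fin n → Set
Adj G u v = ((u , v) ∈ G) ⊎ ((v , u) ∈ G)

ContainsP5 : ∀ {n} → Graph n → Set
ContainsP5 {n} G =
  Σ (Fin n) λ a → Σ (Fin n) λ b → Σ (Fin n) λ c → Σ (Fin n) λ d → Σ (Fin n) λ e →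
    (a ≢ b × a ≢ c × a ≢ d × a ≢ e × b ≢ c × b ≢ d × b ≢ e × c ≢ d × c ≢ e × d ≢ e)
    × Adj G a b × Adj G b c × Adj G c d × Adj G d e

P5Free : ∀ {n} → Graph n → Set
P5Free G = ¬ ContainsP5 G

Legal : ∀ {n} → Graph n → Fin n → Fin n → Set
Legal G u v = (u ≢ v) × ¬ Adj G u v × P5Free ((u , v) ∷ G)

Saturated : ∀ {n} → Graph n → Set
Saturated G = ∀ u v → ¬ Legal G u v

data Player : Set where
  prolonger shortener : Player

-- AtLeast k p G : from position G with player p to move, Prolonger has a
-- strategy guaranteeing that at least k more edges are added.
data AtLeast {n : ℕ} : ℕ → Player → Graph n → Set where
  done : ∀ {p G} → AtLeast 0 p G
  pmove : ∀ {k G} u v → Legal G u v → AtLeast k shortener ((u , v) ∷ G) →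
          AtLeast (suc k) prolonger G
  smove : ∀ {k G} u₀ v₀ → Legal G u₀ v₀ →
          (∀ u v → Legal G u v → AtLeast k prolonger ((u , v) ∷ G)) →
          AtLeast (suc k) shortener G

-- AtMost k p G : from position G with player p to move, Shortener has a
-- strategy guaranteeing that at most k more edges are added.
data AtMost {n : ℕ} : ℕ → Player → Graph n → Set where
  over : ∀ {k p G} → Saturated G → AtMost k p G
  smove : ∀ {k G} u v → Legal G u v → AtMost k prolonger ((u , v) ∷ G) →
          AtMost (suc k) shortener G
  pmove : ∀ {k G} → (∀ u v → Legal G u v → AtMost k shortener ((u , v) ∷ G)) →
          AtMost (suc k) prolonger G

IsGameValue : ∀ {n} → ℕ → Player → Graph n → Set
IsGameValue g p G = AtLeast g p G × AtMost g p G

IsGameSatNumber : (n : ℕ) → Player → ℕ → Set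
IsGameSatNumber n first g = IsGameValue {n} g first []

{-# OPTIONS --safe #-}
module Submission where

-- A connected P5-free graph is a star, a double star, a triangle with pendant edges at one
-- vertex, or a 4-cycle with some of its chords. A graph in the game is a disjoint union of
-- these, and a move either joins two components or adds an edge inside one, so the game can
-- be played on multisets of component shapes.
-- A component has as many edges as vertices, up to −1 for a tree and up to +2 for a shape on
-- a 4-cycle. Prolonger can always leave at most one nontrivial tree, and that one a path on at
-- most 4 vertices, so he can go on until at most one tree is left and n − 1 edges are present.
-- Shortener can always leave at most one single edge, at most one path on 3 vertices and no
-- component that can still become K4; she fails only when so few isolated vertices are left
-- that at most one K4 can arise at all, and then at most n + 2 edges are added whatever
-- happens.

open import Defs
open import Algebra.Properties.CommutativeSemigroup using (interchange)
open import Data.Bool using (Bool; true; false)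
open import Data.Empty using (⊥; ⊥-elim)
open import Data.Fin using (Fin; zero; suc)
open import Data.Fin.Patterns using (0F; 1F; 2F; 3F; 4F)
import Data.Fin.Properties as Fin
open import Data.List using (List; []; _∷_; [_]; _++_; map; concatMap; length; lookup; removeAt; allFin)
open import Data.List.Membership.DecPropositional using (_∈?_)
open import Data.List.Membership.Propositional using (_∈_; find)
open import Data.List.Membership.Propositional.Properties using (∈-++⁺ˡ; ∈-++⁺ʳ; ∈-++⁻; ∈-map⁺; ∈-∃++; ∈-lookup; ∈-concatMap⁻; ∈-allFin)
open import Data.List.Properties using (++-identityʳ; ++-assoc; map-++; map-∘; length-map; length-++; length-tabulate)
open import Data.List.Relation.Binary.Disjoint.Propositional using (Disjoint)
open import Data.List.Relation.Binary.Permutation.Homogeneous using (Permutation; refl; prep; swap; trans)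
open import Data.List.Relation.Binary.Permutation.Propositional as Perm using (_↭_; ↭-refl; ↭-sym; ↭-trans; ↭-prep; ↭-swap; ↭-reflexive)
import Data.List.Relation.Binary.Permutation.Propositional.Properties as Perm
import Data.List.Relation.Binary.Permutation.Setoid.Properties as PermS
open import Data.List.Relation.Binary.Pointwise as Pointwise using ([]; _∷_)
open import Data.List.Relation.Unary.All as All using (All; []; _∷_)
import Data.List.Relation.Unary.All.Properties as All
open import Data.List.Relation.Unary.AllPairs using ([]; _∷_)
open import Data.List.Relation.Unary.Any as Any using (Any; here; there)
import Data.List.Relation.Unary.Any.Properties as Any using (lookup-index)
open import Data.List.Relation.Unary.Unique.DecPropositional using (unique?)
open import Data.List.Relation.Unary.Unique.Propositional using (Unique)
import Data.List.Relation.Unary.Unique.Propositional.Properties as Unique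
open import Data.Nat using (ℕ; zero; suc; pred; _+_; _*_; _∸_; _≤_; _<_; z≤n; s≤s)
open import Data.Nat.ListAction using (sum)
open import Data.Nat.ListAction.Properties using (sum-↭; sum-++)
open import Data.Nat.Properties hiding (_≟_)
open import Data.Nat.Solver using (module +-*-Solver)
open import Data.Product as Product using (Σ; ∃; _×_; _,_; proj₁; proj₂; -,_)
import Data.Product.Properties as Product
open import Data.Sum as Sum using (_⊎_; inj₁; inj₂)
open import Data.Unit using (tt)
open import Function using (_∘_; id)
open import Level using (0ℓ)
open import Relation.Binary.Bundles using (Setoid)
open import Relation.Binary.PropositionalEquality as ≡ using (_≡_; _≢_; refl; sym; cong; cong₂; subst; setoid; ≢-sym; module ≡-Reasoning)
open import Relation.Nullary using (¬_; contradiction; Dec; yes; no; ¬?; _×-dec_; _⊎-dec_)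
open import Relation.Nullary.Decidable using (True; toWitness)

-- Both strategies turn on dead ends. A double star whose hubs both have at least two leaves can
-- never gain a cycle: it stays a tree to the end and costs one edge. So Prolonger closes a tree
-- while it is small; he can afford to leave one small tree, because a single opposing step makes at
-- worst a second edge or a tree that one step still closes. On the other side, a 4-cycle arises
-- only inside a component with exactly 4 vertices, so attaching a fifth vertex removes the danger
-- for good. Shortener needs an isolated vertex at hand for this, and a potential measures what may
-- still go wrong once too few are left.
--
-- The two directions of the passage to shapes differ in difficulty. For a move of one's own,
-- P5-freeness follows from the shape of the result. For the opponent's move every pair of vertices
-- has to be examined, and a pair that fits no step has to be refuted by an explicit P5 or an edge
-- already present.

private variable
  n : ℕ
  G H : Graph n

-- Graphs up to order and orientation of the edges

Edge : ℕ → Set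
Edge n = Fin n × Fin n

data _~_ {n : ℕ} : Edge n → Edge n → Set where
  same : ∀ {e} → e ~ e
  flip : ∀ {u v} → (u , v) ~ (v , u)

~-sym : ∀ {e f : Edge n} → e ~ f → f ~ e
~-sym same = same
~-sym flip = flip

~-trans : ∀ {e f g : Edge n} → e ~ f → f ~ g → e ~ g
~-trans same q = q
~-trans flip same = flip
~-trans flip flip = same

edgeSetoid : ℕ → Setoid 0ℓ 0ℓ
edgeSetoid n = record
  { Carrier = Edge n
  ; _≈_ = _~_
  ; isEquivalence = record { refl = same ; sym = ~-sym ; trans = ~-trans }
  }

-- Equality of edge lists up to order of the list and orientation of the edges.
infix 3 _≈_
_≈_ : Graph n → Graph n → Set
_≈_ = Permutation _~_

↭⇒≈ : G ↭ H → G ≈ H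
↭⇒≈ = Perm.↭⇒↭ₛ′ (Setoid.isEquivalence (edgeSetoid _))

≈-refl : G ≈ G
≈-refl = ↭⇒≈ ↭-refl

≈-sym : G ≈ H → H ≈ G
≈-sym (refl p) = refl (Pointwise.symmetric ~-sym p)
≈-sym (prep e p) = prep (~-sym e) (≈-sym p)
≈-sym (swap e f p) = swap (~-sym f) (~-sym e) (≈-sym p)
≈-sym (trans p q) = trans (≈-sym q) (≈-sym p)

≈-++ : ∀ {G G′ H H′ : Graph n} → G ≈ G′ → H ≈ H′ → G ++ H ≈ G′ ++ H′
≈-++ = PermS.++⁺ (edgeSetoid _)

≈-length : G ≈ H → length G ≡ length H
≈-length = PermS.xs↭ys⇒|xs|≡|ys| (edgeSetoid _)

Adj-resp-≈ : ∀ {u v} → G ≈ H → Adj G u v → Adj H u v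
Adj-resp-≈ {G = G} {H = H} p = Sum.[ to , Sum.swap ∘ to ]
  where
  from : ∀ {a b K} → Any ((a , b) ~_) K → Adj K a b
  from (here same) = inj₁ (here refl)
  from (here flip) = inj₂ (here refl)
  from (there f) = Sum.map there there (from f)

  to : ∀ {a b} → (a , b) ∈ G → Adj H a b
  to = from ∘ PermS.Any-resp-↭ (edgeSetoid _) (λ q r → ~-trans r q) p ∘ Any.map (λ { refl → same })

-- `i` is the position, in what remains of the left list, of the next edge of the right list. Nested
-- calls of this and of `take↭` spell out a permutation by positions, as in a selection sort.
take≈ : ∀ {e : Edge n} i → lookup G i ~ e → removeAt G i ≈ H → G ≈ e ∷ H
take≈ {G = _ ∷ _} zero eq p = prep eq p
take≈ {G = f ∷ _} (suc i) eq p =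
  trans (prep same (take≈ i eq ≈-refl)) (trans (swap same same ≈-refl) (prep same p))

take↭ : ∀ {xs ys : List (Fin n)} i → removeAt xs i ↭ ys → xs ↭ lookup xs i ∷ ys
take↭ {xs = _ ∷ _} zero p = ↭-prep _ p
take↭ {xs = x ∷ _} (suc i) p =
  ↭-trans (↭-prep x (take↭ i ↭-refl)) (↭-trans (↭-swap _ _ ↭-refl) (↭-prep _ p))

P5-map : (∀ {u v} → Adj G u v → Adj H u v) → ContainsP5 G → ContainsP5 H
P5-map f (a , b , c , d , e , ≢s , ab , bc , cd , de) =
  a , b , c , d , e , ≢s , f ab , f bc , f cd , f de

path⇒P5 : ∀ {a b c d e} → Unique (a ∷ b ∷ c ∷ d ∷ e ∷ []) →
  Adj G a b → Adj G b c → Adj G c d → Adj G d e → ContainsP5 G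
path⇒P5 ((ab ∷ ac ∷ ad ∷ ae ∷ []) ∷ (bc ∷ bd ∷ be ∷ []) ∷ (cd ∷ ce ∷ []) ∷ (de ∷ []) ∷ [] ∷ []) p q r s =
  -, -, -, -, -, (ab , ac , ad , ae , bc , bd , be , cd , ce , de) , p , q , r , s

lookup-injective : ∀ {vs : List (Fin n)} → Unique vs → ∀ {i j} → lookup vs i ≡ lookup vs j → i ≡ j
lookup-injective (_ ∷ _) {zero} {zero} _ = refl
lookup-injective (x∉ ∷ _) {zero} {suc j} eq = contradiction eq (All.lookup x∉ (∈-lookup j))
lookup-injective (x∉ ∷ _) {suc i} {zero} eq = contradiction (sym eq) (All.lookup x∉ (∈-lookup i))
lookup-injective (_ ∷ vs!) {suc i} {suc j} eq = cong suc (lookup-injective vs! eq)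

-- Distinctness of the positions is decided by evaluation, so an explicit path can be given by the
-- positions of its vertices in a duplicate-free vertex list.
select : ∀ {vs : List (Fin n)} → Unique vs → (is : List (Fin (length vs))) →
  {True (unique? Fin._≟_ is)} → Unique (map (lookup vs) is)
select vs! is {is!} = Unique.map⁺ (lookup-injective vs!) (toWitness is!)

Unique-resp-↭ : ∀ {xs ys : List (Fin n)} → xs ↭ ys → Unique xs → Unique ys
Unique-resp-↭ p = PermS.Unique-resp-↭ (setoid _) (Perm.↭⇒↭ₛ p)

-- Components, their shapes and the steps between shapes

data Shape : Set where
  star : ℕ → Shape
  dstar : ℕ → ℕ → Shape
  tri : ℕ → Shape
  four : Shape

data Component (n : ℕ) : Set where
  star : (x : Fin n) (L : List (Fin n)) → Component n
  dstar : (x y l m : Fin n) (L M : List (Fin n)) → Component n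
  tri : (x s t : Fin n) (L : List (Fin n)) → Component n
  four : (a b c d : Fin n) (p q : Bool) → Component n

-- star x L has hub x and leaves L (an isolated vertex if L is empty), dstar x y l m L M has
-- adjacent hubs x and y with leaves l ∷ L and m ∷ M, tri x s t L is the triangle x s t with
-- leaves L at x, and p and q say whether the cycle a b c d has the chords ac and bd. The
-- shape of a double star counts the leaves in L and M only, so dstar 0 0 is the path on 4 vertices.
shape : Component n → Shape
shape (star x L) = star (length L)
shape (dstar x y l m L M) = dstar (length L) (length M)
shape (tri x s t L) = tri (length L)
shape (four a b c d p q) = four

verts : Component n → List (Fin n)
verts (star x L) = x ∷ L
verts (dstar x y l m L M) = x ∷ y ∷ l ∷ m ∷ L ++ M
verts (tri x s t L) = x ∷ s ∷ t ∷ L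
verts (four a b c d p q) = a ∷ b ∷ c ∷ d ∷ []

spokes : Fin n → List (Fin n) → Graph n
spokes x = map (x ,_)

chord : Bool → Edge n → Graph n
chord true e = e ∷ []
chord false e = []

edges : Component n → Graph n
edges (star x L) = spokes x L
edges (dstar x y l m L M) = (x , y) ∷ (x , l) ∷ (y , m) ∷ spokes x L ++ spokes y M
edges (tri x s t L) = (s , t) ∷ (x , s) ∷ (x , t) ∷ spokes x L
edges (four a b c d p q) = (a , b) ∷ (b , c) ∷ (c , d) ∷ (d , a) ∷ chord p (a , c) ++ chord q (b , d)

infix 3 _⇒_ _⟶_

-- The steps of _⇒_ can be played from every graph containing the components on the left. The
-- further steps of _⟶_ only have to be recognised when the opponent plays them.
data _⇒_ : List Shape → Shape → Set where
  iso-star : ∀ {a} → star 0 ∷ star a ∷ [] ⇒ star (suc a)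
  iso-dstarˡ : ∀ {a b} → star 0 ∷ dstar a b ∷ [] ⇒ dstar (suc a) b
  iso-dstarʳ : ∀ {a b} → star 0 ∷ dstar a b ∷ [] ⇒ dstar a (suc b)
  iso-tri : ∀ {a} → star 0 ∷ tri a ∷ [] ⇒ tri (suc a)
  star-star : ∀ {a b} → star (suc a) ∷ star (suc b) ∷ [] ⇒ dstar a b
  close-star : ∀ {a} → star (2 + a) ∷ [] ⇒ tri a
  close-dstarˡ : ∀ {a} → dstar a 0 ∷ [] ⇒ tri (suc a)
  close-dstarʳ : ∀ {b} → dstar 0 b ∷ [] ⇒ tri (suc b)
  close-path : dstar 0 0 ∷ [] ⇒ four

data _⟶_ : List Shape → Shape → Set where
  regular : ∀ {ρ s} → ρ ⇒ s → ρ ⟶ s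
  iso-leaf : ∀ {a} → star 0 ∷ star (2 + a) ∷ [] ⟶ dstar a 0
  close-tri : tri 1 ∷ [] ⟶ four
  new-chord : four ∷ [] ⟶ four

-- The target shape of a step does not say which vertices are its hubs and leaves, so the concrete
-- component is kept as a witness.
record Grows (vs : List (Fin n)) (es : Graph n) (u v : Fin n) (s : Shape) : Set where
  constructor grows
  field
    result : Component n
    shape≡ : shape result ≡ s
    verts↭ : verts result ↭ vs
    edges≈ : edges result ≈ (u , v) ∷ es

Grows-resp : ∀ {vs vs′ : List (Fin n)} {es es′ u v s} → vs ↭ vs′ → es ≈ es′ →
  Grows vs es u v s → Grows vs′ es′ u v s
Grows-resp p q (grows c sh r t) = grows c sh (↭-trans r p) (trans t (prep same q))

Grows-sym : ∀ {vs : List (Fin n)} {es u v s} → Grows vs es u v s → Grows vs es v u s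
Grows-sym (grows c sh p q) = grows c sh p (trans q (prep flip ≈-refl))

-- The component produced by each step

module _ {n : ℕ} where

  private variable
    a b c d x y s t l m k u : Fin n
    L M : List (Fin n)
    q : Bool

  add-iso-star : Grows (u ∷ x ∷ L) (spokes x L) u x (star (suc (length L)))
  add-iso-star = Grows-sym (grows (star _ (_ ∷ _)) refl (↭-swap _ _ ↭-refl) ≈-refl)

  add-iso-dstarˡ : ∀ L M → Grows (u ∷ verts (dstar x y l m L M)) (edges (dstar x y l m L M)) u x
    (dstar (suc (length L)) (length M))
  add-iso-dstarˡ {u} {x} {y} {l} {m} L M = Grows-sym (grows (dstar x y u m (l ∷ L) M) refl
    (take↭ 2F (take↭ 0F (take↭ 0F (take↭ 1F ↭-refl))))
    (take≈ 1F same (take≈ 0F same (take≈ 1F same ≈-refl))))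

  add-iso-dstarʳ : ∀ L M → Grows (u ∷ verts (dstar x y l m L M)) (edges (dstar x y l m L M)) u y
    (dstar (length L) (suc (length M)))
  add-iso-dstarʳ {u} {x} {y} {l} {m} L M = Grows-sym (grows (dstar x y l m L (u ∷ M)) refl
    (Perm.shift u (x ∷ y ∷ l ∷ m ∷ L) _)
    (↭⇒≈ (Perm.shift (y , u) ((x , y) ∷ (x , l) ∷ (y , m) ∷ spokes x L) _)))

  add-iso-tri : Grows (u ∷ verts (tri x s t L)) (edges (tri x s t L)) u x (tri (suc (length L)))
  add-iso-tri {u} {x} {s} {t} = Grows-sym (grows (tri _ _ _ (_ ∷ _)) refl
    (Perm.shift u (x ∷ s ∷ t ∷ []) _)
    (↭⇒≈ (Perm.shift (x , u) ((s , t) ∷ (x , s) ∷ (x , t) ∷ []) _)))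

  join-stars : Grows ((x ∷ l ∷ L) ++ (y ∷ m ∷ M)) (spokes x (l ∷ L) ++ spokes y (m ∷ M)) x y
    (dstar (length L) (length M))
  join-stars {x} {l} {L} {y} {m} {M} = grows (dstar x y l m L M) refl
    (↭-prep x (↭-trans (↭-swap y l ↭-refl) (↭-prep l (↭-sym (Perm.shifts L (y ∷ m ∷ []))))))
    (↭⇒≈ (↭-prep _ (↭-prep _ (↭-sym (Perm.shift _ (spokes x L) _)))))

  close-star-leaves : Grows (x ∷ s ∷ t ∷ L) (spokes x (s ∷ t ∷ L)) s t (tri (length L))
  close-star-leaves = grows (tri _ _ _ _) refl ↭-refl ≈-refl

  close-dstar-hubˡ : Grows (verts (dstar x y l m L [])) (edges (dstar x y l m L [])) x m
    (tri (suc (length L)))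
  close-dstar-hubˡ {L = L} = grows (tri _ _ _ (_ ∷ _)) refl
    (take↭ 0F (take↭ 0F (take↭ 1F (↭-prep _ (↭-reflexive (sym (++-identityʳ L)))))))
    (take≈ 2F same (take≈ 1F same (take≈ 1F same (prep same (↭⇒≈ (↭-reflexive (sym (++-identityʳ _))))))))

  close-dstar-hubʳ : Grows (verts (dstar x y l m [] M)) (edges (dstar x y l m [] M)) y l
    (tri (suc (length M)))
  close-dstar-hubʳ = grows (tri _ _ _ (_ ∷ _)) refl
    (take↭ 1F (take↭ 0F ↭-refl))
    (take≈ 2F same (take≈ 1F flip (take≈ 0F same (≈-refl))))

  close-path-ends : Grows (verts (dstar x y l m [] [])) (edges (dstar x y l m [] [])) l m four
  close-path-ends {x} {y} {l} {m} = grows (four l x y m false false) refl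
    (take↭ 1F (take↭ 1F (take↭ 0F ↭-refl)))
    (take≈ 3F flip (take≈ 1F same (take≈ 0F flip ≈-refl)))

  -- The leaf `l` becomes the second hub, with `u` as its leaf; `k` takes over as the distinguished
  -- leaf of `x`.
  add-iso-leaf : Grows (u ∷ x ∷ l ∷ k ∷ L) (spokes x (l ∷ k ∷ L)) u l (dstar (length L) 0)
  add-iso-leaf {u} {x} {l} {k} {L} = Grows-sym (grows (dstar x l k u L []) refl
    (take↭ 3F (take↭ 0F (↭-prep l (↭-prep k (↭-reflexive (++-identityʳ L))))))
    (take≈ 2F same (≈-++ (≈-refl {G = (x , l) ∷ (x , k) ∷ []}) (↭⇒≈ (↭-reflexive (++-identityʳ _))))))

  -- The 4-cycle is `x l s t`; the old triangle edge `x s` turns into a chord.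
  close-tri-leaf : Grows (verts (tri x s t (l ∷ []))) (edges (tri x s t (l ∷ []))) s l four
  close-tri-leaf {x} {s} {t} {l} = grows (four x l s t true false) refl
    (take↭ 0F (take↭ 1F (take↭ 1F ↭-refl)))
    (take≈ 1F flip (take≈ 1F same (take≈ 2F same (take≈ 1F flip ≈-refl))))

  add-chord : Grows (verts (four a b c d false q)) (edges (four a b c d false q)) a c four
  add-chord {q = q} = grows (four _ _ _ _ true q) refl ↭-refl (take≈ 4F same ≈-refl)

-- Different presentations of one component

record _≅_ (c d : Component n) : Set where
  field
    verts↭ : verts c ↭ verts d
    edges≈ : edges c ≈ edges d

≅-refl : ∀ {c : Component n} → c ≅ c
≅-refl = record { verts↭ = ↭-refl ; edges≈ = ≈-refl }

≅-trans : ∀ {b c d : Component n} → b ≅ c → c ≅ d → b ≅ d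
≅-trans p q = record
  { verts↭ = ↭-trans (_≅_.verts↭ p) (_≅_.verts↭ q)
  ; edges≈ = trans (_≅_.edges≈ p) (_≅_.edges≈ q) }

star-rotate : ∀ {x y : Fin n} → star x (y ∷ []) ≅ star y (x ∷ [])
star-rotate = record { verts↭ = ↭-swap _ _ ↭-refl ; edges≈ = prep flip ≈-refl }

star-leaves : ∀ {x : Fin n} {L L′} → L ↭ L′ → star x L ≅ star x L′
star-leaves p = record { verts↭ = ↭-prep _ p ; edges≈ = ↭⇒≈ (Perm.map⁺ _ p) }

dstar-flip : ∀ {x y l m : Fin n} {L M} → dstar x y l m L M ≅ dstar y x m l M L
dstar-flip {x = x} {y} {L = L} {M} = record
  { verts↭ = take↭ 1F (take↭ 0F (take↭ 1F (take↭ 0F (Perm.++-comm L M))))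
  ; edges≈ = prep flip (take≈ 1F same (take≈ 0F same (↭⇒≈ (Perm.++-comm (spokes x L) (spokes y M)))))
  }

dstar-leaves : ∀ {x y l l′ m : Fin n} {L L′ M} → l ∷ L ↭ l′ ∷ L′ → dstar x y l m L M ≅ dstar x y l′ m L′ M
dstar-leaves {x = x} {y} {l} {l′} {m} {L} {L′} {M} p = record
  { verts↭ = ↭-prep x (↭-prep y (↭-trans (↭-swap _ _ ↭-refl)
      (↭-trans (↭-prep m (Perm.++⁺ʳ M p)) (↭-swap _ _ ↭-refl))))
  ; edges≈ = ↭⇒≈ (↭-prep _ (↭-trans (↭-swap _ _ ↭-refl)
      (↭-trans (↭-prep _ (Perm.++⁺ʳ (spokes y M) (Perm.map⁺ _ p))) (↭-swap _ _ ↭-refl))))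
  }

tri-leaves : ∀ {x s t : Fin n} {L L′} → L ↭ L′ → tri x s t L ≅ tri x s t L′
tri-leaves p = record
  { verts↭ = ↭-prep _ (↭-prep _ (↭-prep _ p))
  ; edges≈ = ↭⇒≈ (↭-prep _ (↭-prep _ (↭-prep _ (Perm.map⁺ _ p)))) }

tri-flip : ∀ {x s t : Fin n} {L} → tri x s t L ≅ tri x t s L
tri-flip = record
  { verts↭ = take↭ 0F (take↭ 1F ↭-refl) ; edges≈ = take≈ 0F flip (take≈ 1F same ≈-refl) }

tri-rotate : ∀ {x s t : Fin n} → tri x s t [] ≅ tri s t x []
tri-rotate = record
  { verts↭ = take↭ 1F (take↭ 1F ↭-refl)
  ; edges≈ = take≈ 2F flip (take≈ 0F same (take≈ 0F flip ≈-refl)) }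

four-rotate : ∀ {a b c d : Fin n} {p q} → four a b c d p q ≅ four b c d a q p
four-rotate {p = p} {q} = record
  { verts↭ = take↭ 1F (take↭ 1F (take↭ 1F ↭-refl))
  ; edges≈ = take≈ 1F same (take≈ 1F same (take≈ 1F same (prep same (diagonals p q)))) }
  where
  diagonals : ∀ {a b c d : Fin n} p q →
    chord p (a , c) ++ chord q (b , d) ≈ chord q (b , d) ++ chord p (c , a)
  diagonals true true = take≈ 1F same (take≈ 0F flip ≈-refl)
  diagonals true false = prep flip ≈-refl
  diagonals false true = ≈-refl
  diagonals false false = ≈-refl

-- Components contain no P5

Within : List (Fin n) → Graph n → Set
Within vs = All λ (u , v) → u ∈ vs × v ∈ vs

within : ∀ {vs u v} → Within vs G → Adj G u v → u ∈ vs × v ∈ vs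
within w (inj₁ e) = All.lookup w e
within w (inj₂ e) = Product.swap (All.lookup w e)

spokes⁺ : ∀ {P : Edge n → Set} {x : Fin n} {L} → (∀ {l} → l ∈ L → P (x , l)) → All P (spokes x L)
spokes⁺ f = All.map⁺ (All.tabulate f)

chord⁺ : ∀ {P : Edge n → Set} {e} p → P e → All P (chord p e)
chord⁺ true Pe = Pe ∷ []
chord⁺ false Pe = []

edges-within : ∀ (c : Component n) → Within (verts c) (edges c)
edges-within (star x L) = spokes⁺ λ l∈ → here refl , there l∈
edges-within (dstar x y l m L M) =
  (here refl , there (here refl)) ∷
  (here refl , there (there (here refl))) ∷
  (there (here refl) , there (there (there (here refl)))) ∷
  All.++⁺ (spokes⁺ λ l∈ → here refl , there (there (there (there (∈-++⁺ˡ l∈)))))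
          (spokes⁺ λ m∈ → there (here refl) , there (there (there (there (∈-++⁺ʳ L m∈)))))
edges-within (tri x s t L) =
  (there (here refl) , there (there (here refl))) ∷
  (here refl , there (here refl)) ∷
  (here refl , there (there (here refl))) ∷
  spokes⁺ λ l∈ → here refl , there (there (there l∈))
edges-within (four a b c d p q) =
  (here refl , there (here refl)) ∷
  (there (here refl) , there (there (here refl))) ∷
  (there (there (here refl)) , there (there (there (here refl)))) ∷
  (there (there (there (here refl))) , here refl) ∷
  All.++⁺ (chord⁺ p (here refl , there (there (here refl))))
          (chord⁺ q (there (here refl) , there (there (there (here refl)))))

Within-++ : ∀ {vs ws} → Within vs G → Within ws H → Within (vs ++ ws) (G ++ H)
Within-++ {vs = vs} p q =
  All.++⁺ (All.map (λ (a , b) → ∈-++⁺ˡ a , ∈-++⁺ˡ b) p)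
          (All.map (λ (a , b) → ∈-++⁺ʳ vs a , ∈-++⁺ʳ vs b) q)

Adj-++⁻ : ∀ (G : Graph n) {u v} → Adj (G ++ H) u v → Adj G u v ⊎ Adj H u v
Adj-++⁻ G (inj₁ e) = Sum.map inj₁ inj₁ (∈-++⁻ G e)
Adj-++⁻ G (inj₂ e) = Sum.map inj₂ inj₂ (∈-++⁻ G e)

-- The first edge of a path decides its side, and disjointness of the vertex sets keeps each later
-- edge on that side.
P5Free-++ : ∀ {vs ws} → Within vs G → Within ws H → Disjoint vs ws →
  P5Free G → P5Free H → P5Free (G ++ H)
P5Free-++ {G = G} {H = H} {vs} {ws} inG inH disj freeG freeH (a , b , c , d , e , ≢s , ab , bc , cd , de)
  with Adj-++⁻ G ab
... | inj₁ ab′ = freeG (a , b , c , d , e , ≢s , ab′ , bc′ , cd′ , de′)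
  where
  stay : ∀ {u v} → u ∈ vs → Adj (G ++ H) u v → Adj G u v
  stay u∈ uv with Adj-++⁻ G uv
  ... | inj₁ p = p
  ... | inj₂ p = contradiction (u∈ , proj₁ (within inH p)) disj
  bc′ = stay (proj₂ (within inG ab′)) bc
  cd′ = stay (proj₂ (within inG bc′)) cd
  de′ = stay (proj₂ (within inG cd′)) de
... | inj₂ ab′ = freeH (a , b , c , d , e , ≢s , ab′ , bc′ , cd′ , de′)
  where
  stay : ∀ {u v} → u ∈ ws → Adj (G ++ H) u v → Adj H u v
  stay u∈ uv with Adj-++⁻ G uv
  ... | inj₂ p = p
  ... | inj₁ p = contradiction (proj₁ (within inG p) , u∈) disj
  bc′ = stay (proj₂ (within inH ab′)) bc
  cd′ = stay (proj₂ (within inH bc′)) cd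
  de′ = stay (proj₂ (within inH cd′)) de

Cover : (p q : Fin n) → Graph n → Set
Cover p q = All λ (u , v) → (u ≡ p ⊎ u ≡ q) ⊎ (v ≡ p ⊎ v ≡ q)

cover : ∀ {p q u v} → Cover p q G → Adj G u v → (u ≡ p ⊎ u ≡ q) ⊎ (v ≡ p ⊎ v ≡ q)
cover w (inj₁ e) = All.lookup w e
cover w (inj₂ e) = Sum.swap (All.lookup w e)

-- The only two-element vertex cover of a path a b c d e is {b , d}.
cover-P5 : ∀ {p q} → Cover p q G → ((a , b , c , d , e , _) : ContainsP5 G) →
  (b ≡ p × d ≡ q) ⊎ (b ≡ q × d ≡ p)
cover-P5 {n} {p = p} {q} cov (a , b , c , d , e , (a≢b , a≢c , a≢d , a≢e , b≢c , b≢d , b≢e , c≢d , c≢e , d≢e) , ab , bc , cd , de) =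
  decide (Sum.[ ⊥-elim ∘ a∉ , id ] (cover cov ab)) (Sum.[ id , ⊥-elim ∘ e∉ ] (cover cov de))
  where
  W : Fin n → Set
  W z = z ≡ p ⊎ z ≡ q

  third : ∀ {x y z} → x ≢ y → x ≢ z → y ≢ z → W x → W y → W z → ⊥
  third x≢y x≢z y≢z (inj₁ refl) (inj₁ refl) _ = x≢y refl
  third x≢y x≢z y≢z (inj₁ refl) (inj₂ refl) (inj₁ refl) = x≢z refl
  third x≢y x≢z y≢z (inj₁ refl) (inj₂ refl) (inj₂ refl) = y≢z refl
  third x≢y x≢z y≢z (inj₂ refl) (inj₁ refl) (inj₁ refl) = y≢z refl
  third x≢y x≢z y≢z (inj₂ refl) (inj₁ refl) (inj₂ refl) = x≢z refl
  third x≢y x≢z y≢z (inj₂ refl) (inj₂ refl) _ = x≢y refl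

  -- If `a` were in the cover, the edge `cd` together with `bc` or `de` would put two more vertices
  -- of the path into it, three distinct ones in all. `e∉` is the mirror image.
  a∉ : ¬ W a
  a∉ Wa with cover cov cd
  ... | inj₁ Wc = Sum.[ third a≢c a≢d c≢d Wa Wc , third a≢c a≢e c≢e Wa Wc ] (cover cov de)
  ... | inj₂ Wd = Sum.[ (λ Wb → third a≢b a≢d b≢d Wa Wb Wd) , (λ Wc → third a≢c a≢d c≢d Wa Wc Wd) ] (cover cov bc)

  e∉ : ¬ W e
  e∉ We with cover cov bc
  ... | inj₁ Wb = Sum.[ (λ Wc → third b≢c b≢e c≢e Wb Wc We) , (λ Wd → third b≢d b≢e d≢e Wb Wd We) ] (cover cov cd)
  ... | inj₂ Wc = Sum.[ (λ Wa → third a≢c a≢e c≢e Wa Wc We) , (λ Wb → third b≢c b≢e c≢e Wb Wc We) ] (cover cov ab)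

  decide : W b → W d → (b ≡ p × d ≡ q) ⊎ (b ≡ q × d ≡ p)
  decide (inj₁ refl) (inj₁ refl) = contradiction refl b≢d
  decide (inj₁ b≡p) (inj₂ d≡q) = inj₁ (b≡p , d≡q)
  decide (inj₂ b≡q) (inj₁ d≡p) = inj₂ (b≡q , d≡p)
  decide (inj₂ refl) (inj₂ refl) = contradiction refl b≢d

star-cover : ∀ (x : Fin n) L → Cover x x (spokes x L)
star-cover _ _ = spokes⁺ λ _ → inj₁ (inj₁ refl)

dstar-cover : ∀ (x y l m : Fin n) L M → Cover x y (edges (dstar x y l m L M))
dstar-cover _ _ _ _ L M = inj₁ (inj₁ refl) ∷ inj₁ (inj₁ refl) ∷ inj₁ (inj₂ refl) ∷
  All.++⁺ (spokes⁺ {L = L} λ _ → inj₁ (inj₁ refl)) (spokes⁺ {L = M} λ _ → inj₁ (inj₂ refl))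

tri-coverˢ : ∀ (x s t : Fin n) L → Cover x s (edges (tri x s t L))
tri-coverˢ _ _ _ _ = inj₁ (inj₂ refl) ∷ inj₁ (inj₁ refl) ∷ inj₁ (inj₁ refl) ∷ spokes⁺ λ _ → inj₁ (inj₁ refl)

tri-coverᵗ : ∀ (x s t : Fin n) L → Cover x t (edges (tri x s t L))
tri-coverᵗ _ _ _ _ = inj₂ (inj₂ refl) ∷ inj₁ (inj₁ refl) ∷ inj₁ (inj₁ refl) ∷ spokes⁺ λ _ → inj₁ (inj₁ refl)

dstar-leafˡ : ∀ {x y l m : Fin n} {L M} → Unique (verts (dstar x y l m L M)) → ∀ {z} →
  Adj (edges (dstar x y l m L M)) x z → z ≢ y → z ∈ l ∷ L
dstar-leafˡ {x = x} {y} {l} {m} {L} {M} ((x≢y ∷ x≢l ∷ x≢m ∷ x∉) ∷ _) {z} xz z≢y = from xz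
  where
  P : Edge _ → Set
  P (u , v) = (u ≡ x → v ≡ z → z ∈ l ∷ L) × (u ≡ z → v ≡ x → z ∈ l ∷ L)
  all : All P (edges (dstar x y l m L M))
  all = ((λ _ eq → contradiction (sym eq) z≢y) , (λ _ eq → contradiction (sym eq) x≢y)) ∷
    ((λ { _ refl → here refl }) , (λ _ eq → contradiction (sym eq) x≢l)) ∷
    ((λ eq _ → contradiction (sym eq) x≢y) , (λ _ eq → contradiction (sym eq) x≢m)) ∷
    All.++⁺ (spokes⁺ λ l∈ → (λ { _ refl → there l∈ }) ,
                            (λ { _ refl → contradiction refl (All.lookup x∉ (∈-++⁺ˡ l∈)) }))
            (spokes⁺ λ m∈ → (λ eq _ → contradiction (sym eq) x≢y) ,
                            (λ { _ refl → contradiction refl (All.lookup x∉ (∈-++⁺ʳ L m∈)) }))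
  from : Adj (edges (dstar x y l m L M)) x z → z ∈ l ∷ L
  from (inj₁ e) = proj₁ (All.lookup all e) refl refl
  from (inj₂ e) = proj₂ (All.lookup all e) refl refl

Unique-++⁻ : ∀ (xs : List (Fin n)) {ys} → Unique (xs ++ ys) → Unique xs × Unique ys × Disjoint xs ys
Unique-++⁻ [] ys! = [] , ys! , λ ()
Unique-++⁻ (x ∷ xs) (x∉ ∷ xs!) with Unique-++⁻ xs xs!
... | xs!′ , ys! , disj = All.++⁻ˡ xs x∉ ∷ xs!′ , ys! ,
  λ { (here refl , z∈) → contradiction refl (All.lookup (All.++⁻ʳ xs x∉) z∈)
    ; (there z∈ , z∈′) → disj (z∈ , z∈′) }

-- A common neighbour of the hubs would lie in both leaf lists, which the duplicate-free vertex list
-- keeps disjoint.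
dstar-common : ∀ (x y l m : Fin n) L M → Unique (verts (dstar x y l m L M)) → ∀ {z} →
  Adj (edges (dstar x y l m L M)) x z → Adj (edges (dstar x y l m L M)) y z → z ≢ x → z ≢ y → ⊥
dstar-common x y l m L M vs! xz yz z≢x z≢y = disj
  ( dstar-leafˡ vs! xz z≢y
  , dstar-leafˡ (Unique-resp-↭ (_≅_.verts↭ flipped) vs!) (Adj-resp-≈ (_≅_.edges≈ flipped) yz) z≢x )
  where
  flipped : dstar x y l m L M ≅ dstar y x m l M L
  flipped = dstar-flip
  leaves! : Unique ((l ∷ L) ++ (m ∷ M))
  leaves! = Unique-resp-↭ (↭-prep l (↭-sym (Perm.shift m L M)))
    (proj₁ (proj₂ (Unique-++⁻ (x ∷ y ∷ []) {l ∷ m ∷ L ++ M} vs!)))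
  disj : Disjoint (l ∷ L) (m ∷ M)
  disj = proj₂ (proj₂ (Unique-++⁻ (l ∷ L) leaves!))

Unique-length : ∀ {xs ys : List (Fin n)} → Unique xs → All (_∈ ys) xs → length xs ≤ length ys
Unique-length {xs = xs} {ys} xs! xs⊆ys = Fin.injective⇒≤ {f = pos} inj
  where
  pos : Fin (length xs) → Fin (length ys)
  pos i = Any.index (All.lookup xs⊆ys (∈-lookup i))
  inj : ∀ {i j} → pos i ≡ pos j → i ≡ j
  inj {i} {j} eq = lookup-injective xs! (begin
    lookup xs i ≡⟨ Any.lookup-index (All.lookup xs⊆ys (∈-lookup i)) ⟩
    lookup ys (pos i) ≡⟨ cong (lookup ys) eq ⟩
    lookup ys (pos j) ≡⟨ Any.lookup-index (All.lookup xs⊆ys (∈-lookup j)) ⟨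
    lookup xs j ∎)
    where
    open ≡-Reasoning

-- Small vertex covers determine the second and fourth vertex of a P5. A star has a cover by one
-- vertex only; in a double star the two would be the hubs, with the middle vertex as a common
-- neighbour; a triangle with leaves has the two covers `x s` and `x t`, which cannot both be the
-- same pair. A 4-cycle has too few vertices.
component-free : ∀ (c : Component n) → Unique (verts c) → P5Free (edges c)
component-free (star x L) _ p@(_ , _ , _ , _ , _ , (_ , _ , _ , _ , _ , b≢d , _) , _)
  with cover-P5 (star-cover x L) p
... | inj₁ (refl , refl) = b≢d refl
... | inj₂ (refl , refl) = b≢d refl
component-free {n} (dstar x y l m L M) vs! p@(a , b , c , d , e , (_ , _ , _ , _ , b≢c , b≢d , _ , c≢d , _) , _ , bc , cd , _)
  with cover-P5 (dstar-cover x y l m L M) p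
... | inj₁ (refl , refl) = dstar-common x y l m L M vs! bc (Sum.swap cd) (≢-sym b≢c) c≢d
... | inj₂ (refl , refl) = dstar-common x y l m L M vs! (Sum.swap cd) bc c≢d (≢-sym b≢c)
component-free (tri x s t L) vs! p@(_ , _ , _ , _ , _ , (_ , _ , _ , _ , _ , b≢d , _) , _)
  with cover-P5 (tri-coverˢ x s t L) p | cover-P5 (tri-coverᵗ x s t L) p | vs!
... | inj₁ (refl , refl) | inj₁ (_ , refl) | _ ∷ (s≢t ∷ _) ∷ _ = s≢t refl
... | inj₁ (refl , refl) | inj₂ (_ , refl) | _ = b≢d refl
... | inj₂ (refl , refl) | inj₁ (refl , _) | _ = b≢d refl
... | inj₂ (refl , refl) | inj₂ (refl , _) | _ ∷ (s≢t ∷ _) ∷ _ = s≢t refl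
component-free f@(four _ _ _ _ _ _) vs! (a , b , c , d , e , (a≢b , a≢c , a≢d , a≢e , b≢c , b≢d , b≢e , c≢d , c≢e , d≢e) , ab , bc , cd , de) =
  1+n≰n (Unique-length
    ((a≢b ∷ a≢c ∷ a≢d ∷ a≢e ∷ []) ∷ (b≢c ∷ b≢d ∷ b≢e ∷ []) ∷ (c≢d ∷ c≢e ∷ []) ∷ (d≢e ∷ []) ∷ [] ∷ [])
    (proj₁ (inside ab) ∷ proj₁ (inside bc) ∷ proj₁ (inside cd) ∷ proj₁ (inside de) ∷ proj₂ (inside de) ∷ []))
  where
  inside : ∀ {u v} → Adj (edges f) u v → u ∈ verts f × v ∈ verts f
  inside = within (edges-within f)

-- Moves inside one component

record Move (us : List (Fin n)) (c : Component n) (u v : Fin n) : Set where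
  constructor move
  field
    vs! : Unique (us ++ verts c)
    distinct : u ≢ v
    fresh : ¬ Adj (edges c) u v
    p5Free : P5Free ((u , v) ∷ edges c)

open Move

∷-flip : ∀ {u v a b : Fin n} → Adj ((u , v) ∷ G) a b → Adj ((v , u) ∷ G) a b
∷-flip = Adj-resp-≈ (prep flip ≈-refl)

Move-sym : ∀ {us} {c : Component n} {u v} → Move us c u v → Move us c v u
Move-sym (move vs! u≢v ¬uv free) = move vs! (≢-sym u≢v) (¬uv ∘ Sum.swap) (free ∘ P5-map ∷-flip)

Move-≅ : ∀ {us} {c d : Component n} {u v} → c ≅ d → Move us c u v → Move us d u v
Move-≅ {us = us} c≅d (move vs! u≢v ¬uv free) = move
  (Unique-resp-↭ (Perm.++⁺ˡ us (_≅_.verts↭ c≅d)) vs!) u≢v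
  (¬uv ∘ Adj-resp-≈ (≈-sym (_≅_.edges≈ c≅d)))
  (free ∘ P5-map (Adj-resp-≈ (prep same (≈-sym (_≅_.edges≈ c≅d)))))

-- `us` lists the isolated vertices that take part beside `c`: none for a move inside `c`, and
-- `[ u ]` when an isolated `u` is attached. One record thus serves both kinds of move.
record Outcome (us : List (Fin n)) (c : Component n) (u v : Fin n) : Set where
  constructor outcome
  field
    {target} : Shape
    step : map (λ _ → star 0) us ++ shape c ∷ [] ⟶ target
    growth : Grows (us ++ verts c) (edges c) u v target

Outcome-sym : ∀ {us} {c : Component n} {u v} → Outcome us c u v → Outcome us c v u
Outcome-sym (outcome st g) = outcome st (Grows-sym g)

-- The "without loss of generality" principle: the component may be presented so that the vertices
-- concerned stand at fixed positions.
via-≅ : ∀ {us} {c d : Component n} {u v} → c ≅ d → shape d ≡ shape c →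
  (Move us d u v → Outcome us d u v) → Move us c u v → Outcome us c u v
via-≅ {us = us} c≅d sh f mv with outcome st g ← f (Move-≅ c≅d mv) =
  outcome (subst (λ z → map _ us ++ z ∷ [] ⟶ _) sh st)
    (Grows-resp (Perm.++⁺ˡ us (↭-sym (_≅_.verts↭ c≅d))) (≈-sym (_≅_.edges≈ c≅d)) g)

extract : ∀ {A : Set} {u : A} {L} → u ∈ L → ∃ λ L′ → L ↭ u ∷ L′
extract u∈ with as , bs , refl ← ∈-∃++ u∈ = as ++ bs , Perm.shift _ as bs

extract₂ : ∀ {u v : Fin n} {L} → u ∈ L → v ∈ L → u ≢ v → ∃ λ L′ → L ↭ u ∷ v ∷ L′
extract₂ u∈ v∈ u≢v with extract u∈
... | L₁ , p with Perm.∈-resp-↭ p v∈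
... | here v≡u = contradiction (sym v≡u) u≢v
... | there v∈₁ with extract v∈₁
... | L₂ , q = L₂ , ↭-trans p (↭-prep _ q)

↭-tail-length : ∀ {A : Set} {a b : A} {xs ys} → a ∷ xs ↭ b ∷ ys → length ys ≡ length xs
↭-tail-length p = sym (cong pred (Perm.↭-length p))

pattern at0 = here refl
pattern at1 = there at0
pattern at2 = there at1
pattern at3 = there at2
pattern at4 = there at3

dstar-view : ∀ {z x y l m : Fin n} {L M} → z ∈ verts (dstar x y l m L M) →
  z ≡ x ⊎ z ≡ y ⊎ z ∈ l ∷ L ⊎ z ∈ m ∷ M
dstar-view (here z≡x) = inj₁ z≡x
dstar-view (there (here z≡y)) = inj₂ (inj₁ z≡y)
dstar-view (there (there (here z≡l))) = inj₂ (inj₂ (inj₁ (here z≡l)))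
dstar-view (there (there (there (here z≡m)))) = inj₂ (inj₂ (inj₂ (here z≡m)))
dstar-view {L = L} (there (there (there (there z∈)))) =
  inj₂ (inj₂ (Sum.map there there (∈-++⁻ L z∈)))

dstar-leafˡ-adj : ∀ {x y l m : Fin n} L M {z} → z ∈ l ∷ L → Adj (edges (dstar x y l m L M)) x z
dstar-leafˡ-adj L M at0 = inj₁ at1
dstar-leafˡ-adj L M (there z∈) = inj₁ (there (there (there (∈-++⁺ˡ (∈-map⁺ _ z∈)))))

dstar-leafʳ-adj : ∀ {x y l m : Fin n} L M {z} → z ∈ m ∷ M → Adj (edges (dstar x y l m L M)) y z
dstar-leafʳ-adj L M at0 = inj₁ at2
dstar-leafʳ-adj {x = x} L M (there z∈) =
  inj₁ (there (there (there (∈-++⁺ʳ (spokes x L) (∈-map⁺ _ z∈)))))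

tri-leaf-adj : ∀ {x s t : Fin n} {L z} → z ∈ L → Adj (edges (tri x s t L)) x z
tri-leaf-adj z∈ = inj₁ (there (there (there (∈-map⁺ _ z∈))))

four-first : ∀ {a b c d z : Fin n} {p q} → z ∈ verts (four a b c d p q) →
  ∃ λ b′ → ∃ λ c′ → ∃ λ d′ → ∃ λ p′ → ∃ λ q′ → four a b c d p q ≅ four z b′ c′ d′ p′ q′
four-first at0 = -, -, -, -, -, ≅-refl
four-first at1 = -, -, -, -, -, four-rotate
four-first at2 = -, -, -, -, -, ≅-trans four-rotate four-rotate
four-first at3 = -, -, -, -, -, ≅-trans four-rotate (≅-trans four-rotate four-rotate)

inner-star : ∀ {x u v : Fin n} {L} → Move [] (star x L) u v →
  u ∈ x ∷ L → v ∈ x ∷ L → Outcome [] (star x L) u v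
inner-star mv at0 at0 = contradiction refl (distinct mv)
inner-star mv at0 (there v∈) = contradiction (inj₁ (∈-map⁺ _ v∈)) (fresh mv)
inner-star mv (there u∈) at0 = contradiction (inj₂ (∈-map⁺ _ u∈)) (fresh mv)
inner-star {x = x} {u} {v} {L} mv (there u∈) (there v∈) with L′ , p ← extract₂ u∈ v∈ (distinct mv) =
  via-≅ (star-leaves p) (cong star (sym (Perm.↭-length p)))
    (λ _ → outcome (regular close-star) close-star-leaves) mv

module _ {n : ℕ} where

  private variable
    x y l m s t u v : Fin n
    L M : List (Fin n)

  dstar-hub-leaf : v ∈ l ∷ L → Move [] (dstar x y l m L M) y v → Outcome [] (dstar x y l m L M) y v
  dstar-hub-leaf {v} {l} {L} {x} {y} {m} {M} v∈ with extract v∈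
  ... | [] , p = via-≅ (dstar-leaves p) (cong (λ k → dstar k (length M)) (↭-tail-length p))
    λ _ → outcome (regular close-dstarʳ) close-dstar-hubʳ
  -- With a second leaf `k` at `x`, the new edge completes the path `m y v x k`.
  ... | k ∷ _ , p = via-≅ (dstar-leaves p) (cong (λ k → dstar k (length M)) (↭-tail-length p))
    λ mv → ⊥-elim (p5Free mv (path⇒P5 (select (vs! mv) (3F ∷ 1F ∷ 2F ∷ 0F ∷ 4F ∷ []))
      (inj₂ at3) (inj₁ at0) (inj₂ at2) (inj₁ at4)))

  dstar-leaf-leaf : u ∈ l ∷ L → v ∈ l ∷ L → ¬ Move [] (dstar x y l m L M) u v
  dstar-leaf-leaf u∈ v∈ mv with _ , p ← extract₂ u∈ v∈ (distinct mv)
    with mv′ ← Move-≅ (dstar-leaves p) mv =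
    p5Free mv′ (path⇒P5 (select (vs! mv′) (2F ∷ 4F ∷ 0F ∷ 1F ∷ 3F ∷ []))
      (inj₁ at0) (inj₂ at4) (inj₁ at1) (inj₁ at3))

  dstar-end-end : ∀ {l m : Fin n} L M → ¬ (L ≡ [] × M ≡ []) → ¬ Move [] (dstar x y l m L M) l m
  dstar-end-end [] [] ne _ = ne (refl , refl)
  dstar-end-end (k ∷ L) M _ mv = p5Free mv (path⇒P5 (select (vs! mv) (4F ∷ 0F ∷ 1F ∷ 3F ∷ 2F ∷ []))
      (inj₂ at4) (inj₁ at1) (inj₁ at3) (inj₂ at0))
  dstar-end-end [] (k ∷ M) _ mv = dstar-end-end (k ∷ M) [] (λ ())
    (Move-sym (Move-≅ dstar-flip mv))

  dstar-leaf-leaf′ : u ∈ l ∷ L → v ∈ m ∷ M → Move [] (dstar x y l m L M) u v →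
    Outcome [] (dstar x y l m L M) u v
  dstar-leaf-leaf′ {u} {l} {L} {v} {m} {M} {x} {y} u∈ v∈ with extract u∈ | extract v∈
  ... | L′ , p | M′ , q = via-≅
    (≅-trans (dstar-leaves p) (≅-trans dstar-flip (≅-trans (dstar-leaves q) dstar-flip)))
    (cong₂ dstar (↭-tail-length p) (↭-tail-length q)) (ends L′ M′)
    where
    ends : ∀ L M → Move [] (dstar x y u v L M) u v → Outcome [] (dstar x y u v L M) u v
    ends [] [] _ = outcome (regular close-path) close-path-ends
    ends (k ∷ L) M = ⊥-elim ∘ dstar-end-end (k ∷ L) M λ ()
    ends [] (k ∷ M) = ⊥-elim ∘ dstar-end-end [] (k ∷ M) λ ()

  dstar-flip-outcome : Outcome [] (dstar y x m l M L) u v → Outcome [] (dstar x y l m L M) u v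
  dstar-flip-outcome {y} {x} {m} {l} {M} {L} (outcome st (grows c sh p q)) = outcome (⟶-flip st)
    (grows c sh (↭-trans p (_≅_.verts↭ flipped)) (trans q (prep same (_≅_.edges≈ flipped))))
    where
    flipped : dstar y x m l M L ≅ dstar x y l m L M
    flipped = dstar-flip
    ⟶-flip : ∀ {a b s} → dstar a b ∷ [] ⟶ s → dstar b a ∷ [] ⟶ s
    ⟶-flip (regular close-dstarˡ) = regular close-dstarʳ
    ⟶-flip (regular close-dstarʳ) = regular close-dstarˡ
    ⟶-flip (regular close-path) = regular close-path

  inner-dstar : Move [] (dstar x y l m L M) u v →
    u ∈ verts (dstar x y l m L M) → v ∈ verts (dstar x y l m L M) → Outcome [] (dstar x y l m L M) u v
  inner-dstar {x} {y} {l} {m} {L} {M} {u} {v} mv u∈ v∈ = go (dstar-view u∈) (dstar-view v∈)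
    where
    View : Fin n → Set
    View z = z ≡ x ⊎ z ≡ y ⊎ z ∈ l ∷ L ⊎ z ∈ m ∷ M
    go : View u → View v → Outcome [] (dstar x y l m L M) u v
    go (inj₁ refl) (inj₁ refl) = contradiction refl (distinct mv)
    go (inj₁ refl) (inj₂ (inj₁ refl)) = contradiction (inj₁ at0) (fresh mv)
    go (inj₁ refl) (inj₂ (inj₂ (inj₁ v∈))) = contradiction (dstar-leafˡ-adj L M v∈) (fresh mv)
    go (inj₁ refl) (inj₂ (inj₂ (inj₂ v∈))) = dstar-flip-outcome (dstar-hub-leaf v∈ (Move-≅ dstar-flip mv))
    go (inj₂ (inj₁ refl)) (inj₁ refl) = contradiction (inj₂ at0) (fresh mv)
    go (inj₂ (inj₁ refl)) (inj₂ (inj₁ refl)) = contradiction refl (distinct mv)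
    go (inj₂ (inj₁ refl)) (inj₂ (inj₂ (inj₁ v∈))) = dstar-hub-leaf v∈ mv
    go (inj₂ (inj₁ refl)) (inj₂ (inj₂ (inj₂ v∈))) = contradiction (dstar-leafʳ-adj L M v∈) (fresh mv)
    go (inj₂ (inj₂ (inj₁ u∈))) (inj₁ refl) = contradiction (Sum.swap (dstar-leafˡ-adj L M u∈)) (fresh mv)
    go (inj₂ (inj₂ (inj₁ u∈))) (inj₂ (inj₁ refl)) = Outcome-sym (dstar-hub-leaf u∈ (Move-sym mv))
    go (inj₂ (inj₂ (inj₁ u∈))) (inj₂ (inj₂ (inj₁ v∈))) = ⊥-elim (dstar-leaf-leaf u∈ v∈ mv)
    go (inj₂ (inj₂ (inj₁ u∈))) (inj₂ (inj₂ (inj₂ v∈))) = dstar-leaf-leaf′ u∈ v∈ mv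
    go (inj₂ (inj₂ (inj₂ u∈))) (inj₁ refl) =
      Outcome-sym (dstar-flip-outcome (dstar-hub-leaf u∈ (Move-≅ dstar-flip (Move-sym mv))))
    go (inj₂ (inj₂ (inj₂ u∈))) (inj₂ (inj₁ refl)) = contradiction (Sum.swap (dstar-leafʳ-adj L M u∈)) (fresh mv)
    go (inj₂ (inj₂ (inj₂ u∈))) (inj₂ (inj₂ (inj₁ v∈))) = Outcome-sym (dstar-leaf-leaf′ v∈ u∈ (Move-sym mv))
    go (inj₂ (inj₂ (inj₂ u∈))) (inj₂ (inj₂ (inj₂ v∈))) = ⊥-elim (dstar-leaf-leaf u∈ v∈ (Move-≅ dstar-flip mv))

  -- If `v` is the only leaf, the move closes a 4-cycle with one chord; a second leaf `k` gives the
  -- path `k x v s t`.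
  tri-base-leaf : v ∈ L → Move [] (tri x s t L) s v → Outcome [] (tri x s t L) s v
  tri-base-leaf v∈ with extract v∈
  ... | [] , p = via-≅ (tri-leaves p) (cong tri (sym (Perm.↭-length p)))
    λ _ → outcome close-tri close-tri-leaf
  ... | k ∷ _ , p = via-≅ (tri-leaves p) (cong tri (sym (Perm.↭-length p)))
    λ mv → ⊥-elim (p5Free mv (path⇒P5 (select (vs! mv) (4F ∷ 0F ∷ 3F ∷ 1F ∷ 2F ∷ []))
      (inj₂ (there at4)) (inj₁ at4) (inj₂ at0) (inj₁ at1)))

  tri-base-leaf′ : v ∈ L → Move [] (tri x s t L) t v → Outcome [] (tri x s t L) t v
  tri-base-leaf′ v∈ = via-≅ tri-flip refl (tri-base-leaf v∈)

  tri-leaf-leaf : u ∈ L → v ∈ L → ¬ Move [] (tri x s t L) u v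
  tri-leaf-leaf u∈ v∈ mv with _ , p ← extract₂ u∈ v∈ (distinct mv)
    with mv′ ← Move-≅ (tri-leaves p) mv =
    p5Free mv′ (path⇒P5 (select (vs! mv′) (3F ∷ 4F ∷ 0F ∷ 1F ∷ 2F ∷ []))
      (inj₁ at0) (inj₂ (there at4)) (inj₁ at2) (inj₁ at1))

  inner-tri : Move [] (tri x s t L) u v →
    u ∈ verts (tri x s t L) → v ∈ verts (tri x s t L) → Outcome [] (tri x s t L) u v
  inner-tri mv at0 at0 = contradiction refl (distinct mv)
  inner-tri mv at0 at1 = contradiction (inj₁ at1) (fresh mv)
  inner-tri mv at0 at2 = contradiction (inj₁ at2) (fresh mv)
  inner-tri mv at0 (there (there (there v∈))) = contradiction (tri-leaf-adj v∈) (fresh mv)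
  inner-tri mv at1 at0 = contradiction (inj₂ at1) (fresh mv)
  inner-tri mv at1 at1 = contradiction refl (distinct mv)
  inner-tri mv at1 at2 = contradiction (inj₁ at0) (fresh mv)
  inner-tri mv at1 (there (there (there v∈))) = tri-base-leaf v∈ mv
  inner-tri mv at2 at0 = contradiction (inj₂ at2) (fresh mv)
  inner-tri mv at2 at1 = contradiction (inj₂ at0) (fresh mv)
  inner-tri mv at2 at2 = contradiction refl (distinct mv)
  inner-tri mv at2 (there (there (there v∈))) = tri-base-leaf′ v∈ mv
  inner-tri mv (there (there (there u∈))) at0 = contradiction (Sum.swap (tri-leaf-adj u∈)) (fresh mv)
  inner-tri mv (there (there (there u∈))) at1 = Outcome-sym (tri-base-leaf u∈ (Move-sym mv))
  inner-tri mv (there (there (there u∈))) at2 = Outcome-sym (tri-base-leaf′ u∈ (Move-sym mv))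
  inner-tri mv (there (there (there u∈))) (there (there (there v∈))) = ⊥-elim (tri-leaf-leaf u∈ v∈ mv)

  -- Rotating the cycle puts `u` first, so that only the diagonal at `u` can be a new edge.
  inner-four : ∀ {a b c d : Fin n} {p q} → Move [] (four a b c d p q) u v →
    u ∈ verts (four a b c d p q) → v ∈ verts (four a b c d p q) → Outcome [] (four a b c d p q) u v
  inner-four {u} {v} mv u∈ v∈ with four-first u∈
  ... | b′ , c′ , d′ , p′ , q′ , c≅ = via-≅ c≅ refl (λ mv′ → go p′ mv′ (Perm.∈-resp-↭ (_≅_.verts↭ c≅) v∈)) mv
    where
    go : ∀ p → Move [] (four u b′ c′ d′ p q′) u v → v ∈ verts (four u b′ c′ d′ p q′) →
      Outcome [] (four u b′ c′ d′ p q′) u v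
    go _ mv at0 = contradiction refl (distinct mv)
    go _ mv at1 = contradiction (inj₁ at0) (fresh mv)
    go true mv at2 = contradiction (inj₁ at4) (fresh mv)
    go false mv at2 = outcome new-chord add-chord
    go _ mv at3 = contradiction (inj₂ at3) (fresh mv)

inner : ∀ (c : Component n) {u v} → Move [] c u v → u ∈ verts c → v ∈ verts c → Outcome [] c u v
inner (star _ _) = inner-star
inner (dstar _ _ _ _ _ _) = inner-dstar
inner (tri _ _ _ _) = inner-tri
inner (four _ _ _ _ _ _) = inner-four

-- Moves between two components

module _ {n : ℕ} where

  private variable
    x y l m s t u v : Fin n
    L M : List (Fin n)

  -- At a single edge either end can serve as hub; with more leaves, the chosen leaf becomes the
  -- second hub of a double star.
  iso-star-move : Move [ u ] (star x L) u v → v ∈ verts (star x L) → Outcome [ u ] (star x L) u v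
  iso-star-move mv at0 = outcome (regular iso-star) add-iso-star
  iso-star-move mv (there v∈) with extract v∈
  ... | [] , p = via-≅ (≅-trans (star-leaves p) star-rotate) (cong star (sym (Perm.↭-length p)))
    (λ _ → outcome (regular iso-star) add-iso-star) mv
  ... | _ ∷ _ , p = via-≅ (star-leaves p) (cong star (sym (Perm.↭-length p)))
    (λ _ → outcome iso-leaf add-iso-leaf) mv

  ¬iso-dstar-leaf : v ∈ l ∷ L → ¬ Move [ u ] (dstar x y l m L M) u v
  ¬iso-dstar-leaf v∈ mv with _ , p ← extract v∈ with mv′ ← Move-≅ (dstar-leaves p) mv =
    p5Free mv′ (path⇒P5 (select (vs! mv′) (0F ∷ 3F ∷ 1F ∷ 2F ∷ 4F ∷ []))
      (inj₁ at0) (inj₂ at2) (inj₁ at1) (inj₁ at3))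

  iso-dstar-move : Move [ u ] (dstar x y l m L M) u v → v ∈ verts (dstar x y l m L M) →
    Outcome [ u ] (dstar x y l m L M) u v
  iso-dstar-move {L = L} {M} mv v∈ with dstar-view v∈
  ... | inj₁ refl = outcome (regular iso-dstarˡ) (add-iso-dstarˡ L M)
  ... | inj₂ (inj₁ refl) = outcome (regular iso-dstarʳ) (add-iso-dstarʳ L M)
  ... | inj₂ (inj₂ (inj₁ v∈)) = ⊥-elim (¬iso-dstar-leaf v∈ mv)
  ... | inj₂ (inj₂ (inj₂ v∈)) = ⊥-elim (¬iso-dstar-leaf v∈ (Move-≅ dstar-flip mv))

  -- A bare triangle can take any of its vertices as hub; once `x` has a leaf `k`, the path
  -- `u s t x k` appears.
  iso-tri-base : ∀ {s} L → Move [ u ] (tri x s t L) u s → Outcome [ u ] (tri x s t L) u s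
  iso-tri-base [] = via-≅ tri-rotate refl λ _ → outcome (regular iso-tri) add-iso-tri
  iso-tri-base (k ∷ L) mv = ⊥-elim (p5Free mv (path⇒P5 (select (vs! mv) (0F ∷ 2F ∷ 3F ∷ 1F ∷ 4F ∷ []))
      (inj₁ at0) (inj₁ at1) (inj₂ at3) (inj₁ at4)))

  iso-tri-move : Move [ u ] (tri x s t L) u v → v ∈ verts (tri x s t L) → Outcome [ u ] (tri x s t L) u v
  iso-tri-move mv at0 = outcome (regular iso-tri) add-iso-tri
  iso-tri-move {L = L} mv at1 = iso-tri-base L mv
  iso-tri-move {L = L} mv at2 = via-≅ tri-flip refl (iso-tri-base L) mv
  iso-tri-move mv (there (there (there v∈))) with _ , p ← extract v∈ with mv′ ← Move-≅ (tri-leaves p) mv =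
    ⊥-elim (p5Free mv′ (path⇒P5 (select (vs! mv′) (0F ∷ 4F ∷ 1F ∷ 2F ∷ 3F ∷ []))
      (inj₁ at0) (inj₂ at4) (inj₁ at2) (inj₁ at1)))

  ¬iso-four-move : ∀ {a b c d : Fin n} {p q} → v ∈ verts (four a b c d p q) → ¬ Move [ u ] (four a b c d p q) u v
  ¬iso-four-move v∈ mv with _ , _ , _ , _ , _ , c≅ ← four-first v∈ with mv′ ← Move-≅ c≅ mv =
    p5Free mv′ (path⇒P5 (select (vs! mv′) (0F ∷ 1F ∷ 2F ∷ 3F ∷ 4F ∷ []))
      (inj₁ at0) (inj₁ at1) (inj₁ at2) (inj₁ at3))

  attach : ∀ (c : Component n) → Move [ u ] c u v → v ∈ verts c → Outcome [ u ] c u v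
  attach (star _ _) = iso-star-move
  attach (dstar _ _ _ _ _ _) = iso-dstar-move
  attach (tri _ _ _ _) = iso-tri-move
  attach (four _ _ _ _ _ _) mv v∈ = ⊥-elim (¬iso-four-move v∈ mv)

-- A deep vertex starts a path on 3 vertices: an edge from it to a non-isolated vertex of
-- another component closes a P5.
data Kind {n : ℕ} (u : Fin n) (c : Component n) : Set where
  isolated : c ≡ star u [] → Kind u c
  hub : ∀ {l L} → c ≅ star u (l ∷ L) → shape c ≡ star (suc (length L)) → Kind u c
  deep : ∀ {y z} → Unique (u ∷ y ∷ z ∷ []) → Adj (edges c) u y → Adj (edges c) y z → Kind u c

deep-≅ : ∀ {c d : Component n} {u y z} → c ≅ d → Unique (u ∷ y ∷ z ∷ []) →
  Adj (edges d) u y → Adj (edges d) y z → Kind u c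
deep-≅ c≅d ! uy yz = deep ! (Adj-resp-≈ (≈-sym (_≅_.edges≈ c≅d)) uy) (Adj-resp-≈ (≈-sym (_≅_.edges≈ c≅d)) yz)

unique-≅ : ∀ {c d : Component n} → c ≅ d → Unique (verts c) → Unique (verts d)
unique-≅ c≅d = Unique-resp-↭ (_≅_.verts↭ c≅d)

dstar-leaf-kind : ∀ {x y l m : Fin n} {L M u} → Unique (verts (dstar x y l m L M)) → u ∈ l ∷ L →
  Kind u (dstar x y l m L M)
dstar-leaf-kind vs! u∈ with _ , p ← extract u∈ =
  deep-≅ (dstar-leaves p) (select (unique-≅ (dstar-leaves p) vs!) (2F ∷ 0F ∷ 1F ∷ [])) (inj₂ at1) (inj₁ at0)

dstar-kind : ∀ {x y l m : Fin n} {L M u} → Unique (verts (dstar x y l m L M)) →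
  u ≡ x ⊎ u ≡ y ⊎ u ∈ l ∷ L ⊎ u ∈ m ∷ M → Kind u (dstar x y l m L M)
dstar-kind vs! (inj₁ refl) = deep (select vs! (0F ∷ 1F ∷ 3F ∷ [])) (inj₁ at0) (inj₁ at2)
dstar-kind vs! (inj₂ (inj₁ refl)) = deep (select vs! (1F ∷ 0F ∷ 2F ∷ [])) (inj₂ at0) (inj₁ at1)
dstar-kind vs! (inj₂ (inj₂ (inj₁ u∈))) = dstar-leaf-kind vs! u∈
dstar-kind {L = L} {M} vs! (inj₂ (inj₂ (inj₂ u∈))) with dstar-leaf-kind (unique-≅ (dstar-flip {L = L} {M}) vs!) u∈
... | deep ! uy yz = deep-≅ dstar-flip ! uy yz

kind : ∀ (c : Component n) {u} → Unique (verts c) → u ∈ verts c → Kind u c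
kind (star x []) vs! at0 = isolated refl
kind (star x (l ∷ L)) vs! at0 = hub ≅-refl refl
kind (star x L) vs! (there u∈) with extract u∈
... | [] , p = hub (≅-trans (star-leaves p) star-rotate) (cong star (Perm.↭-length p))
... | k ∷ _ , p = deep-≅ (star-leaves p) (select (unique-≅ (star-leaves p) vs!) (1F ∷ 0F ∷ 2F ∷ []))
  (inj₂ at0) (inj₁ at1)
kind (dstar x y l m L M) vs! u∈ = dstar-kind vs! (dstar-view u∈)
kind (tri x s t L) vs! at0 = deep (select vs! (0F ∷ 1F ∷ 2F ∷ [])) (inj₁ at1) (inj₁ at0)
kind (tri x s t L) vs! at1 = deep (select vs! (1F ∷ 2F ∷ 0F ∷ [])) (inj₁ at0) (inj₂ at2)
kind (tri x s t L) vs! at2 = deep (select vs! (2F ∷ 1F ∷ 0F ∷ [])) (inj₂ at0) (inj₂ at1)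
kind (tri x s t L) vs! (there (there (there u∈))) with _ , p ← extract u∈ =
  deep-≅ (tri-leaves p) (select (unique-≅ (tri-leaves p) vs!) (3F ∷ 0F ∷ 1F ∷ [])) (inj₂ at3) (inj₁ at1)
kind (four a b c d p q) vs! u∈ with _ , _ , _ , _ , _ , c≅ ← four-first u∈ =
  deep-≅ c≅ (select (unique-≅ c≅ vs!) (0F ∷ 1F ∷ 2F ∷ [])) (inj₁ at0) (inj₁ at1)

record CrossMove (c d : Component n) (u v : Fin n) : Set where
  constructor crossMove
  field
    vs! : Unique (verts c ++ verts d)
    u∈ : u ∈ verts c
    v∈ : v ∈ verts d
    p5Free : P5Free ((u , v) ∷ edges c ++ edges d)

record Joined (c d : Component n) (u v : Fin n) : Set where
  constructor joined
  field
    {target} : Shape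
    step : shape c ∷ shape d ∷ [] ⟶ target
    growth : Grows (verts c ++ verts d) (edges c ++ edges d) u v target

CrossMove-sym : ∀ {c d : Component n} {u v} → CrossMove c d u v → CrossMove d c v u
CrossMove-sym {c = c} {d} (crossMove vs! u∈ v∈ free) = crossMove
  (Unique-resp-↭ (Perm.++-comm (verts c) (verts d)) vs!) v∈ u∈
  (free ∘ P5-map (Adj-resp-≈ (prep flip (↭⇒≈ (Perm.++-comm (edges d) (edges c))))))

-- The P5 is `z y u v w`: two edges on the side of `u`, the new edge, and one edge on the side of
-- `v`.
¬cross-deep : ∀ {c d : Component n} {u v y z w} → Unique (u ∷ y ∷ z ∷ []) → Adj (edges c) u y → Adj (edges c) y z →
  Adj (edges d) v w → v ≢ w → ¬ CrossMove c d u v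
¬cross-deep {c = c} {d} {u} {v} {y} {z} {w} uyz! uy yz vw v≢w (crossMove vs! u∈ v∈ free) =
  free (path⇒P5 zyuvw!
    (lift (inj₁ (Sum.swap yz))) (lift (inj₁ (Sum.swap uy))) (inj₁ at0) (lift (inj₂ vw)))
  where
  lift : ∀ {a b} → Adj (edges c) a b ⊎ Adj (edges d) a b → Adj ((u , v) ∷ edges c ++ edges d) a b
  lift (inj₁ p) = Sum.map (there ∘ ∈-++⁺ˡ) (there ∘ ∈-++⁺ˡ) p
  lift (inj₂ p) = Sum.map (there ∘ ∈-++⁺ʳ (edges c)) (there ∘ ∈-++⁺ʳ (edges c)) p
  w∈ : w ∈ verts d
  w∈ = proj₂ (within (edges-within d) vw)
  zyu⊆ : ∀ {a} → a ∈ z ∷ y ∷ u ∷ [] → a ∈ verts c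
  zyu⊆ at0 = proj₂ (within (edges-within c) yz)
  zyu⊆ at1 = proj₁ (within (edges-within c) yz)
  zyu⊆ at2 = u∈
  vw⊆ : ∀ {a} → a ∈ v ∷ w ∷ [] → a ∈ verts d
  vw⊆ at0 = v∈
  vw⊆ at1 = w∈
  zyuvw! : Unique (z ∷ y ∷ u ∷ v ∷ w ∷ [])
  zyuvw! = Unique.++⁺ (select uyz! (2F ∷ 1F ∷ 0F ∷ [])) ((v≢w ∷ []) ∷ [] ∷ [])
    λ (a∈ , a∈′) → proj₂ (proj₂ (Unique-++⁻ (verts c) vs!)) (zyu⊆ a∈ , vw⊆ a∈′)

join-isolated : ∀ {u v} (d : Component n) → CrossMove (star u []) d u v → Joined (star u []) d u v
join-isolated {u = u} d (crossMove vs!@(u∉ ∷ _) _ v∈ free) = joined (Outcome.step out) (Outcome.growth out)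
  where
  u∉d : ¬ (u ∈ verts d)
  u∉d u∈ = contradiction refl (All.lookup u∉ u∈)
  out : Outcome [ u ] d _ _
  out = attach d (move vs! (λ { refl → u∉d v∈ }) (u∉d ∘ proj₁ ∘ within (edges-within d)) free) v∈

join-hubs : ∀ {c d : Component n} {u v l m L M} → c ≅ star u (l ∷ L) → shape c ≡ star (suc (length L)) →
  d ≅ star v (m ∷ M) → shape d ≡ star (suc (length M)) → Joined c d u v
join-hubs {c = c} {d} c≅ shc d≅ shd = joined
  (subst (λ s → s ∷ _ ⟶ _) (sym shc) (subst (λ s → _ ∷ s ∷ [] ⟶ _) (sym shd) (regular star-star)))
  (Grows-resp (↭-sym (Perm.++⁺ (_≅_.verts↭ c≅) (_≅_.verts↭ d≅)))
    (≈-sym (≈-++ (_≅_.edges≈ c≅) (_≅_.edges≈ d≅))) join-stars)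

hub-neighbour : ∀ {d : Component n} {v m M} → Unique (verts d) → d ≅ star v (m ∷ M) →
  ∃ λ w → Adj (edges d) v w × v ≢ w
hub-neighbour vs! d≅ with (v≢m ∷ _) ∷ _ ← unique-≅ d≅ vs! =
  -, Adj-resp-≈ (≈-sym (_≅_.edges≈ d≅)) (inj₁ at0) , v≢m

-- Unless one end is isolated, both ends must be hubs of stars, since a deep end meeting a
-- non-isolated vertex closes a P5. The result is a sum because the steps list an isolated vertex
-- first, and it may be on either side.
cross : ∀ (c d : Component n) {u v} → CrossMove c d u v → Joined c d u v ⊎ Joined d c v u
cross c d mv@(crossMove vs! u∈ v∈ free) with Unique-++⁻ (verts c) vs!
... | c! , d! , _ with kind c c! u∈ | kind d d! v∈
... | isolated refl | _ = inj₁ (join-isolated d mv)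
... | hub _ _ | isolated refl = inj₂ (join-isolated c (CrossMove-sym mv))
... | hub c≅ shc | hub d≅ shd = inj₁ (join-hubs c≅ shc d≅ shd)
... | hub c≅ _ | deep ! vy yz with _ , uw , u≢w ← hub-neighbour c! c≅ =
  ⊥-elim (¬cross-deep ! vy yz uw u≢w (CrossMove-sym mv))
... | deep _ _ _ | isolated refl = inj₂ (join-isolated c (CrossMove-sym mv))
... | deep ! uy yz | hub d≅ _ with _ , vw , v≢w ← hub-neighbour d! d≅ =
  ⊥-elim (¬cross-deep ! uy yz vw v≢w mv)
... | deep ! uy yz | deep ((v≢w ∷ _) ∷ _) vw _ = ⊥-elim (¬cross-deep ! uy yz vw v≢w mv)

-- Graphs as multisets of shapes

concatMap-↭ : ∀ {A B : Set} (f : A → List B) {xs ys} → xs ↭ ys → concatMap f xs ↭ concatMap f ys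
concatMap-↭ f Perm.refl = ↭-refl
concatMap-↭ f (Perm.prep x p) = Perm.++⁺ˡ (f x) (concatMap-↭ f p)
concatMap-↭ f (Perm.swap x y p) =
  ↭-trans (Perm.++⁺ˡ (f x) (Perm.++⁺ˡ (f y) (concatMap-↭ f p))) (Perm.shifts (f x) (f y))
concatMap-↭ f (Perm.trans p q) = ↭-trans (concatMap-↭ f p) (concatMap-↭ f q)

allVerts : List (Component n) → List (Fin n)
allVerts = concatMap verts

allEdges : List (Component n) → Graph n
allEdges = concatMap edges

allEdges-within : ∀ (Γ : List (Component n)) → Within (allVerts Γ) (allEdges Γ)
allEdges-within [] = []
allEdges-within (c ∷ Γ) = Within-++ (edges-within c) (allEdges-within Γ)

allEdges-free : ∀ (Γ : List (Component n)) → Unique (allVerts Γ) → P5Free (allEdges Γ)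
allEdges-free [] _ (_ , _ , _ , _ , _ , _ , inj₁ () , _)
allEdges-free [] _ (_ , _ , _ , _ , _ , _ , inj₂ () , _)
allEdges-free (c ∷ Γ) vs! with c! , Γ! , disj ← Unique-++⁻ (verts c) vs! =
  P5Free-++ (edges-within c) (allEdges-within Γ) disj (component-free c c!) (allEdges-free Γ Γ!)

infix 3 _⊨_

record _⊨_ (G : Graph n) (σ : List Shape) : Set where
  constructor model
  field
    components : List (Component n)
    shapes : map shape components ↭ σ
    edges≈ : G ≈ allEdges components
    verts↭ : allVerts components ↭ allFin n

⊨-P5Free : ∀ {σ} → G ⊨ σ → P5Free G
⊨-P5Free (model Γ _ es vs) =
  allEdges-free Γ (Unique-resp-↭ (↭-sym vs) (Unique.allFin⁺ _)) ∘ P5-map (Adj-resp-≈ es)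

grow : ∀ {G : Graph n} {vs es R u v s} → G ≈ es ++ allEdges R → vs ++ allVerts R ↭ allFin n →
  Grows vs es u v s → (u , v) ∷ G ⊨ s ∷ map shape R
grow {R = R} es≈ vs↭ (grows c refl p q) = model (c ∷ R) ↭-refl
  (trans (prep same es≈) (≈-sym (≈-++ q ≈-refl)))
  (↭-trans (Perm.++⁺ʳ (allVerts R) p) vs↭)

record Advance (G : Graph n) (σ : List Shape) (u v : Fin n) : Set where
  constructor advance
  field
    {before rest} : List Shape
    {after} : Shape
    split : σ ↭ before ++ rest
    step : before ⟶ after
    next : (u , v) ∷ G ⊨ after ∷ rest

locate : ∀ {v} (Γ : List (Component n)) → v ∈ allVerts Γ → ∃ λ c → ∃ λ R → Γ ↭ c ∷ R × v ∈ verts c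
locate Γ v∈ with c , c∈ , v∈c ← find (∈-concatMap⁻ verts {xs = Γ} v∈) with R , p ← extract c∈ = c , R , p , v∈c

module _ {G : Graph n} {u v : Fin n} (legal : Legal G u v) where

  private
    G-free : P5Free ((u , v) ∷ G)
    G-free = proj₂ (proj₂ legal)

    restrict : ∀ {es R} → G ≈ es ++ allEdges R → P5Free ((u , v) ∷ es)
    restrict es≈ = G-free ∘ P5-map λ { (inj₁ at0) → inj₁ at0 ; (inj₂ at0) → inj₂ at0
      ; (inj₁ (there e)) → up (inj₁ e) ; (inj₂ (there e)) → up (inj₂ e) }
      where
      up : ∀ {a b} → Adj _ a b → Adj ((u , v) ∷ G) a b
      up = Sum.map there there ∘ Adj-resp-≈ (≈-sym es≈) ∘ Sum.map ∈-++⁺ˡ ∈-++⁺ˡ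

  advance-inner : ∀ {c R σ} → G ≈ edges c ++ allEdges R → verts c ++ allVerts R ↭ allFin n →
    shape c ∷ map shape R ↭ σ → u ∈ verts c → v ∈ verts c → Advance G σ u v
  advance-inner {c} {R} es≈ vs↭ sh u∈ v∈
    with outcome st g ← inner c (move (proj₁ (Unique-++⁻ (verts c) (Unique-resp-↭ (↭-sym vs↭) (Unique.allFin⁺ _))))
      (proj₁ legal) (proj₁ (proj₂ legal) ∘ Adj-resp-≈ (≈-sym es≈) ∘ Sum.map ∈-++⁺ˡ ∈-++⁺ˡ) (restrict {R = R} es≈)) u∈ v∈ =
    advance (↭-sym sh) st (grow {R = R} es≈ vs↭ g)

  advance-cross : ∀ {c d R σ} → G ≈ (edges c ++ edges d) ++ allEdges R →
    (verts c ++ verts d) ++ allVerts R ↭ allFin n →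
    shape c ∷ shape d ∷ map shape R ↭ σ → u ∈ verts c → v ∈ verts d → Advance G σ u v
  advance-cross {c} {d} {R} es≈ vs↭ sh u∈ v∈
    with cross c d (crossMove (proj₁ (Unique-++⁻ (verts c ++ verts d) (Unique-resp-↭ (↭-sym vs↭) (Unique.allFin⁺ _))))
      u∈ v∈ (restrict {R = R} es≈))
  ... | inj₁ (joined st g) = advance (↭-sym sh) st (grow {R = R} es≈ vs↭ g)
  ... | inj₂ (joined st g) = advance (↭-trans (↭-sym sh) (↭-swap _ _ ↭-refl)) st
    (grow {R = R} es≈ vs↭ (Grows-sym (Grows-resp (Perm.++-comm (verts d) (verts c))
      (↭⇒≈ (Perm.++-comm (edges d) (edges c))) g)))

  -- Two cases suffice: `v` lies in the component of `u` or in another one. Both strategies follow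
  -- the opponent's moves through this.
  classify : ∀ {σ} → G ⊨ σ → Advance G σ u v
  classify (model Γ sh es≈ vs↭)
    with c , R , p , u∈ ← locate Γ (Perm.∈-resp-↭ (↭-sym vs↭) (∈-allFin u))
    with ∈-++⁻ (verts c) (Perm.∈-resp-↭ (↭-trans (↭-sym vs↭) (concatMap-↭ verts p)) (∈-allFin v))
  ... | inj₁ v∈ = advance-inner {R = R} (trans es≈ (↭⇒≈ (concatMap-↭ edges p)))
    (↭-trans (↭-sym (concatMap-↭ verts p)) vs↭) (↭-trans (Perm.map⁺ shape (↭-sym p)) sh) u∈ v∈
  ... | inj₂ v∈R with d , R′ , q , v∈ ← locate R v∈R =
    advance-cross {c} {d} {R′}
      (trans es≈ (↭⇒≈ (↭-trans (concatMap-↭ edges p′) (↭-reflexive (sym (++-assoc (edges c) _ _))))))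
      (↭-trans (↭-trans (↭-reflexive (++-assoc (verts c) _ _)) (↭-sym (concatMap-↭ verts p′))) vs↭)
      (↭-trans (Perm.map⁺ shape (↭-sym p′)) sh) u∈ v∈
    where
    p′ : Γ ↭ c ∷ d ∷ R′
    p′ = ↭-trans p (↭-prep c q)

-- Playing a given step on a graph

record Realised (G : Graph n) (σ : List Shape) : Set where
  constructor realised
  field
    {u v} : Fin n
    legal : Legal G u v
    next : (u , v) ∷ G ⊨ σ

realise₁ : ∀ {s t} → s ∷ [] ⇒ t → (c : Component n) → shape c ≡ s → Unique (verts c) →
  ∃ λ u → ∃ λ v → u ∈ verts c × u ≢ v × ¬ Adj (edges c) u v × Grows (verts c) (edges c) u v t
realise₁ close-star (star x (s ∷ t ∷ L)) refl ((x≢s ∷ x≢t ∷ _) ∷ (s≢t ∷ _) ∷ _) =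
  s , t , at1 , s≢t ,
  (λ st → Sum.[ Sum.[ ≢-sym x≢s , ≢-sym x≢s ] , Sum.[ ≢-sym x≢t , ≢-sym x≢t ] ] (cover (star-cover x (s ∷ t ∷ L)) st)) ,
  close-star-leaves
realise₁ close-dstarˡ (dstar x y l m L []) refl vs!@((_ ∷ _ ∷ x≢m ∷ _) ∷ (_ ∷ y≢m ∷ _) ∷ (l≢m ∷ _) ∷ (m∉ ∷ _)) =
  x , m , at0 , x≢m ,
  (λ xm → m∉lL (dstar-leafˡ vs! xm (≢-sym y≢m))) , close-dstar-hubˡ
  where
  m∉lL : ¬ (m ∈ l ∷ L)
  m∉lL (here m≡l) = l≢m (sym m≡l)
  m∉lL (there m∈) = All.lookup m∉ (∈-++⁺ˡ m∈) refl
realise₁ close-dstarʳ (dstar x y l m [] M) refl vs!@((_ ∷ x≢l ∷ _) ∷ (y≢l ∷ _) ∷ (l≢m ∷ l∉) ∷ _) =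
  y , l , at1 , y≢l ,
  (λ yl → l∉mM (dstar-leafˡ {x = y} {x} {m} {l} {M} {[]} (unique-≅ (dstar-flip {L = []} {M}) vs!)
    (Adj-resp-≈ (_≅_.edges≈ (dstar-flip {L = []} {M})) yl) (≢-sym x≢l))) , close-dstar-hubʳ
  where
  l∉mM : ¬ (l ∈ m ∷ M)
  l∉mM (here l≡m) = l≢m l≡m
  l∉mM (there l∈) = All.lookup l∉ l∈ refl
realise₁ close-path (dstar x y l m [] []) refl ((_ ∷ x≢l ∷ x≢m ∷ _) ∷ (y≢l ∷ y≢m ∷ _) ∷ (l≢m ∷ _) ∷ _) =
  l , m , at2 , l≢m ,
  (λ lm → Sum.[ Sum.[ ≢-sym x≢l , ≢-sym y≢l ] , Sum.[ ≢-sym x≢m , ≢-sym y≢m ] ] (cover (dstar-cover x y l m [] []) lm)) ,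
  close-path-ends

realise₂ : ∀ {s t r} → s ∷ t ∷ [] ⇒ r → (c d : Component n) → shape c ≡ s → shape d ≡ t →
  ∃ λ u → ∃ λ v → u ∈ verts c × v ∈ verts d × Grows (verts c ++ verts d) (edges c ++ edges d) u v r
realise₂ iso-star (star u []) (star x L) refl refl = u , x , at0 , at0 , add-iso-star
realise₂ iso-dstarˡ (star u []) (dstar x y l m L M) refl refl = u , x , at0 , at0 , add-iso-dstarˡ L M
realise₂ iso-dstarʳ (star u []) (dstar x y l m L M) refl refl = u , y , at0 , at1 , add-iso-dstarʳ L M
realise₂ iso-tri (star u []) (tri x s t L) refl refl = u , x , at0 , at0 , add-iso-tri
realise₂ star-star (star x (l ∷ L)) (star y (m ∷ M)) refl refl = x , y , at0 , at0 , join-stars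

-- P5-freeness comes from the result: the new graph is again a disjoint union of components. Only
-- distinctness of the ends and freshness of the edge are checked directly.
realise-inner : ∀ {G : Graph n} {σ s t τ} → G ⊨ σ → σ ↭ s ∷ τ → s ∷ [] ⇒ t → Realised G (t ∷ τ)
realise-inner {G = G} (model Γ sh es vs) p r
  with c ∷ R , refl , q ← Perm.↭-map-inv shape (↭-trans sh p)
  with es′ ← trans es (↭⇒≈ (concatMap-↭ edges q)) | vs′ ← ↭-trans (↭-sym (concatMap-↭ verts q)) vs
  with c! , _ , disj ← Unique-++⁻ (verts c) (Unique-resp-↭ (↭-sym vs′) (Unique.allFin⁺ _))
  with u , v , u∈ , u≢v , ¬uv , g ← realise₁ r c refl c! = realised (u≢v , fresh′ , ⊨-P5Free next) next
  where
  next = grow {R = R} es′ vs′ g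
  fresh′ : ¬ Adj G u v
  fresh′ uv = Sum.[ ¬uv , (λ uv → disj (u∈ , proj₁ (within (allEdges-within R) uv))) ]
    (Adj-++⁻ (edges c) (Adj-resp-≈ es′ uv))

realise-cross : ∀ {G : Graph n} {σ s s′ t τ} → G ⊨ σ → σ ↭ s ∷ s′ ∷ τ → s ∷ s′ ∷ [] ⇒ t → Realised G (t ∷ τ)
realise-cross {G = G} (model Γ sh es vs) p r
  with c ∷ d ∷ R , refl , q ← Perm.↭-map-inv shape (↭-trans sh p)
  with es′ ← trans es (↭⇒≈ (concatMap-↭ edges q)) | vs′ ← ↭-trans (↭-sym (concatMap-↭ verts q)) vs
  with c! , dR! , disj ← Unique-++⁻ (verts c) (Unique-resp-↭ (↭-sym vs′) (Unique.allFin⁺ _))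
  with u , v , u∈ , v∈ , g ← realise₂ r c d refl refl = realised ((λ { refl → c∌v u∈ }) , fresh′ , ⊨-P5Free next) next
  where
  c∌v : ¬ (v ∈ verts c)
  c∌v v∈c = disj (v∈c , ∈-++⁺ˡ v∈)
  next = grow {R = R}
    (trans es′ (↭⇒≈ (↭-reflexive (sym (++-assoc (edges c) _ _)))))
    (↭-trans (↭-reflexive (++-assoc (verts c) _ _)) vs′) g
  fresh′ : ¬ Adj G u v
  fresh′ uv = Sum.[ c∌v ∘ proj₂ ∘ within (edges-within c)
                  , (λ uv → disj (u∈ , proj₁ (within (allEdges-within (d ∷ R)) uv))) ]
    (Adj-++⁻ (edges c) (Adj-resp-≈ es′ uv))

realise : ∀ {G : Graph n} {σ ρ s τ} → G ⊨ σ → σ ↭ ρ ++ τ → ρ ⇒ s → Realised G (s ∷ τ)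
realise m p iso-star = realise-cross m p iso-star
realise m p iso-dstarˡ = realise-cross m p iso-dstarˡ
realise m p iso-dstarʳ = realise-cross m p iso-dstarʳ
realise m p iso-tri = realise-cross m p iso-tri
realise m p star-star = realise-cross m p star-star
realise m p close-star = realise-inner m p close-star
realise m p close-dstarˡ = realise-inner m p close-dstarˡ
realise m p close-dstarʳ = realise-inner m p close-dstarʳ
realise m p close-path = realise-inner m p close-path

-- Finite search and determinacy of the game

Adj? : ∀ (G : Graph n) u v → Dec (Adj G u v)
Adj? G u v = _∈?_ (Product.≡-dec Fin._≟_ Fin._≟_) (u , v) G ⊎-dec _∈?_ (Product.≡-dec Fin._≟_ Fin._≟_) (v , u) G

ContainsP5? : ∀ (G : Graph n) → Dec (ContainsP5 G)
ContainsP5? G = Fin.any? λ a → Fin.any? λ b → Fin.any? λ c → Fin.any? λ d → Fin.any? λ e →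
  (a ≢? b ×-dec a ≢? c ×-dec a ≢? d ×-dec a ≢? e ×-dec b ≢? c ×-dec
   b ≢? d ×-dec b ≢? e ×-dec c ≢? d ×-dec c ≢? e ×-dec d ≢? e)
  ×-dec Adj? G a b ×-dec Adj? G b c ×-dec Adj? G c d ×-dec Adj? G d e
  where
  infix 4 _≢?_
  _≢?_ : ∀ (x y : Fin _) → Dec (x ≢ y)
  x ≢? y = ¬? (x Fin.≟ y)

Legal? : ∀ (G : Graph n) u v → Dec (Legal G u v)
Legal? G u v = ¬? (u Fin.≟ v) ×-dec ¬? (Adj? G u v) ×-dec ¬? (ContainsP5? ((u , v) ∷ G))

-- `Q` need not be the complement of `P`. In `determined` the two are claims of the opposing
-- players, and the search goes through without deciding either.
choose : ∀ {m} {P Q : Fin m → Set} → (∀ i → P i ⊎ Q i) → ∃ P ⊎ (∀ i → Q i)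
choose {zero} f = inj₂ λ ()
choose {suc m} f with f zero | choose (f ∘ suc)
... | inj₁ p | _ = inj₁ (zero , p)
... | inj₂ _ | inj₁ (i , p) = inj₁ (suc i , p)
... | inj₂ q | inj₂ qs = inj₂ λ { zero → q ; (suc i) → qs i }

search : ∀ (G : Graph n) {P Q : Fin n → Fin n → Set} → (∀ u v → P u v ⊎ Q u v) →
  (∃ λ u → ∃ λ v → Legal G u v × P u v) ⊎ (∀ u v → Legal G u v → Q u v)
search G {P} {Q} f = choose λ u → choose (at u)
  where
  at : ∀ u v → (Legal G u v × P u v) ⊎ (Legal G u v → Q u v)
  at u v with Legal? G u v | f u v
  ... | yes l | inj₁ p = inj₁ (l , p)
  ... | yes l | inj₂ q = inj₂ λ _ → q
  ... | no ¬l | _ = inj₂ λ l → contradiction l ¬l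

saturated? : ∀ (G : Graph n) → (∃ λ u → ∃ λ v → Legal G u v) ⊎ Saturated G
saturated? G = Sum.map (λ (u , v , l , _) → u , v , l) id (search G {Q = λ _ _ → ⊥} λ _ _ → inj₁ tt)

-- Induction on k: no bound on the length of the game is needed.
determined : ∀ k p (G : Graph n) → AtLeast (suc k) p G ⊎ AtMost k p G
determined zero p G with saturated? G
determined zero prolonger G | inj₁ (u , v , l) = inj₁ (pmove u v l done)
determined zero shortener G | inj₁ (u , v , l) = inj₁ (smove u v l λ _ _ _ → done)
determined zero p G | inj₂ sat = inj₂ (over sat)
determined (suc k) prolonger G with search G (λ u v → determined k shortener ((u , v) ∷ G))
... | inj₁ (u , v , l , w) = inj₁ (pmove u v l w)
... | inj₂ w = inj₂ (pmove w)
determined (suc k) shortener G with search G (λ u v → Sum.swap (determined k prolonger ((u , v) ∷ G))) | saturated? G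
... | inj₁ (u , v , l , w) | _ = inj₂ (smove u v l w)
-- If every move of Shortener is good for Prolonger, a move still has to exist: in a saturated graph
-- `w` holds vacuously.
... | inj₂ w | inj₁ (u , v , l) = inj₁ (smove u v l w)
... | inj₂ _ | inj₂ sat = inj₂ (over sat)

-- An upward search through the `d + 1` candidates from `k` on: `determined` either confirms the
-- current value from above or raises the lower bound by one.
game-value : ∀ d k {p} {G : Graph n} → AtLeast k p G → AtMost (k + d) p G →
  ∃ λ g → IsGameValue g p G × k ≤ g × g ≤ k + d
game-value zero k lo hi =
  k , (lo , subst (λ k → AtMost k _ _) (+-identityʳ k) hi) , ≤-refl , m≤m+n k 0
game-value (suc d) k {p} {G} lo hi with determined k p G
... | inj₂ hi′ = k , (lo , hi′) , ≤-refl , m≤m+n k (suc d)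
... | inj₁ lo′ with g , val , k<g , g≤ ← game-value d (suc k) lo′ (subst (λ k → AtMost k p G) (+-suc k d) hi) =
  g , val , <⇒≤ k<g , subst (g ≤_) (sym (+-suc k d)) g≤

-- Counting shapes and edges

weight : (Shape → ℕ) → List Shape → ℕ
weight w σ = sum (map w σ)

weight-↭ : ∀ w {σ τ} → σ ↭ τ → weight w σ ≡ weight w τ
weight-↭ w p = sum-↭ (Perm.map⁺ w p)

weight-++ : ∀ w ρ τ → weight w (ρ ++ τ) ≡ weight w ρ + weight w τ
weight-++ w ρ τ rewrite map-++ w ρ τ = sum-++ (map w ρ) (map w τ)

weight-split : ∀ w {σ} ρ {τ} → σ ↭ ρ ++ τ → weight w σ ≡ weight w ρ + weight w τ
weight-split w ρ {τ} p = ≡.trans (weight-↭ w p) (weight-++ w ρ τ)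

weight-positive : ∀ w σ {k} → weight w σ ≡ suc k → ∃ λ s → ∃ λ τ → σ ↭ s ∷ τ × ∃ λ j → w s ≡ suc j
weight-positive w (s ∷ σ) eq with w s in ws
... | suc j = s , σ , ↭-refl , j , ws
... | zero with t , τ , p , wt ← weight-positive w σ eq = t , s ∷ τ , ↭-trans (↭-prep s p) (↭-swap s t ↭-refl) , wt

-- near# marks the shapes on 4 vertices, which become K4 if no fifth vertex is attached in time
-- (four itself can only turn into K4).
isolated# edge# path# near# four# : Shape → ℕ
isolated# (star 0) = 1
isolated# _ = 0
edge# (star 1) = 1
edge# _ = 0
path# (star 2) = 1
path# _ = 0
near# (star 3) = 1
near# (dstar 0 0) = 1
near# (tri 1) = 1
near# four = 1
near# _ = 0
four# four = 1
four# _ = 0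

-- Non-increasing under every move, and at least 2 for each component on a 4-cycle.
potential : Shape → ℕ
potential s = 2 * isolated# s + (edge# s + 2 * near# s)

tree# : Shape → ℕ
tree# (star _) = 1
tree# (dstar _ _) = 1
tree# _ = 0

weight-mono : ∀ {w w′} → (∀ s → w s ≤ w′ s) → ∀ σ → weight w σ ≤ weight w′ σ
weight-mono w≤ [] = z≤n
weight-mono w≤ (s ∷ σ) = +-mono-≤ (w≤ s) (weight-mono w≤ σ)

weight-potential : ∀ σ → weight potential σ ≡ 2 * weight isolated# σ + (weight edge# σ + 2 * weight near# σ)
weight-potential [] = refl
weight-potential (s ∷ σ) rewrite weight-potential σ =
  solve 6 (λ i e k i′ e′ k′ → (con 2 :* i :+ (e :+ con 2 :* k)) :+ (con 2 :* i′ :+ (e′ :+ con 2 :* k′))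
      := con 2 :* (i :+ i′) :+ ((e :+ e′) :+ con 2 :* (k :+ k′))) refl
    (isolated# s) (edge# s) (near# s) (weight isolated# σ) (weight edge# σ) (weight near# σ)
  where open +-*-Solver

component-lower : ∀ (c : Component n) → length (verts c) ≤ length (edges c) + tree# (shape c)
component-lower (star x L) rewrite length-map (x ,_) L = ≤-reflexive (+-comm 1 (length L))
component-lower (dstar x y l m L M)
  rewrite length-++ (spokes x L) {spokes y M} | length-++ L {M} | length-map (x ,_) L | length-map (y ,_) M =
  ≤-reflexive (+-comm 1 _)
component-lower (tri x s t L) rewrite length-map (x ,_) L = ≤-reflexive (sym (+-identityʳ _))
component-lower (four a b c d p q) = s≤s (s≤s (s≤s (s≤s z≤n)))

component-upper : ∀ (c : Component n) → length (edges c) ≤ length (verts c) + 2 * four# (shape c)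
component-upper (star x L) rewrite length-map (x ,_) L = m≤n⇒m≤1+n (m≤m+n _ _)
component-upper (dstar x y l m L M)
  rewrite length-++ (spokes x L) {spokes y M} | length-++ L {M} | length-map (x ,_) L | length-map (y ,_) M =
  m≤n⇒m≤1+n (m≤m+n _ _)
component-upper (tri x s t L) rewrite length-map (x ,_) L = m≤m+n _ _
component-upper (four a b c d false false) = s≤s (s≤s (s≤s (s≤s z≤n)))
component-upper (four a b c d false true) = s≤s (s≤s (s≤s (s≤s (s≤s z≤n))))
component-upper (four a b c d true false) = s≤s (s≤s (s≤s (s≤s (s≤s z≤n))))
-- K4 has 6 edges on 4 vertices, the source of the surplus 2.
component-upper (four a b c d true true) = ≤-refl

total-lower : ∀ (Γ : List (Component n)) → length (allVerts Γ) ≤ length (allEdges Γ) + weight tree# (map shape Γ)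
total-lower [] = z≤n
total-lower (c ∷ Γ) rewrite length-++ (verts c) {allVerts Γ} | length-++ (edges c) {allEdges Γ} = begin
  length (verts c) + length (allVerts Γ) ≤⟨ +-mono-≤ (component-lower c) (total-lower Γ) ⟩
  (length (edges c) + tree# (shape c)) + (length (allEdges Γ) + weight tree# (map shape Γ))
    ≡⟨ interchange +-commutativeSemigroup (length (edges c)) _ _ _ ⟩
  (length (edges c) + length (allEdges Γ)) + (tree# (shape c) + weight tree# (map shape Γ)) ∎
  where open ≤-Reasoning

total-upper : ∀ (Γ : List (Component n)) → length (allEdges Γ) ≤ length (allVerts Γ) + 2 * weight four# (map shape Γ)
total-upper [] = z≤n
total-upper (c ∷ Γ) rewrite length-++ (verts c) {allVerts Γ} | length-++ (edges c) {allEdges Γ} = begin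
  length (edges c) + length (allEdges Γ) ≤⟨ +-mono-≤ (component-upper c) (total-upper Γ) ⟩
  (length (verts c) + 2 * four# (shape c)) + (length (allVerts Γ) + 2 * weight four# (map shape Γ))
    ≡⟨ interchange +-commutativeSemigroup (length (verts c)) _ _ _ ⟩
  (length (verts c) + length (allVerts Γ)) + (2 * four# (shape c) + 2 * weight four# (map shape Γ))
    ≡⟨ cong (length (verts c) + length (allVerts Γ) +_) (*-distribˡ-+ 2 (four# (shape c)) (weight four# (map shape Γ))) ⟨
  (length (verts c) + length (allVerts Γ)) + 2 * (four# (shape c) + weight four# (map shape Γ)) ∎
  where open ≤-Reasoning

⊨-size : ∀ {G : Graph n} {σ} (m : G ⊨ σ) → length (allVerts (_⊨_.components m)) ≡ n
⊨-size (model _ _ _ vs) = ≡.trans (Perm.↭-length vs) (length-tabulate id)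

lower-bound : ∀ {G : Graph n} {σ} → G ⊨ σ → n ≤ length G + weight tree# σ
lower-bound m@(model Γ sh es vs) rewrite ≈-length es | sym (weight-↭ tree# sh) =
  subst (_≤ length (allEdges Γ) + weight tree# (map shape Γ)) (⊨-size m) (total-lower Γ)

upper-bound : ∀ {G : Graph n} {σ} → G ⊨ σ → length G ≤ n + 2 * weight four# σ
upper-bound m@(model Γ sh es vs) rewrite ≈-length es | sym (weight-↭ four# sh) =
  subst (λ k → length (allEdges Γ) ≤ k + 2 * weight four# (map shape Γ)) (⊨-size m) (total-upper Γ)

initial : ℕ → List Shape
initial n = map (λ _ → star 0) (allFin n)

start : ∀ n → [] ⊨ initial n
start n = model (map (λ v → star v []) (allFin n))
  (↭-reflexive (sym (map-∘ (allFin n)))) (↭⇒≈ (↭-reflexive (no-edges (allFin n)))) (↭-reflexive (all-vertices (allFin n)))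
  where
  no-edges : ∀ (vs : List (Fin n)) → [] ≡ allEdges (map (λ v → star v []) vs)
  no-edges [] = refl
  no-edges (v ∷ vs) = no-edges vs
  all-vertices : ∀ (vs : List (Fin n)) → allVerts (map (λ v → star v []) vs) ≡ vs
  all-vertices [] = refl
  all-vertices (v ∷ vs) = cong (v ∷_) (all-vertices vs)

initial-weight : ∀ w → w (star 0) ≡ 0 → ∀ n → weight w (initial n) ≡ 0
initial-weight w w0 n = zeros (allFin n)
  where
  zeros : ∀ (vs : List (Fin n)) → weight w (map (λ _ → star 0) vs) ≡ 0
  zeros [] = refl
  zeros (v ∷ vs) rewrite w0 = zeros vs

initial-≤ : ∀ w → w (star 0) ≡ 0 → ∀ n {k} → weight w (initial n) ≤ k
initial-≤ w w0 n = ≤-trans (≤-reflexive (initial-weight w w0 n)) z≤n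

-- Shortener's strategy

record Safe (σ : List Shape) : Set where
  constructor safe
  field
    near≡0 : weight near# σ ≡ 0
    edge≤1 : weight edge# σ ≤ 1
    path≤1 : weight path# σ ≤ 1

-- The shapes on 4 vertices that can still take a fifth one. `four` is left out: any edge from it to
-- an isolated vertex closes a P5.
data Near : Shape → Set where
  star₃ : Near (star 3)
  path₄ : Near (dstar 0 0)
  paw : Near (tri 1)

-- A step makes a single new shape. From a safe position this is either one component on 4 vertices
-- beside a safe rest, or it raises the counts of edges and paths by at most one. This is what
-- Shortener has to answer.
data Loose : List Shape → Set where
  near : ∀ {s σ τ} → Near s → σ ↭ s ∷ τ → Safe τ → Loose σ
  loose : ∀ {σ} → weight near# σ ≡ 0 → weight edge# σ ≤ 2 → weight path# σ ≤ 2 → Loose σ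

near-view : ∀ s → s ≡ four ⊎ Near s ⊎ near# s ≡ 0
near-view (star 0) = inj₂ (inj₂ refl)
near-view (star 1) = inj₂ (inj₂ refl)
near-view (star 2) = inj₂ (inj₂ refl)
near-view (star 3) = inj₂ (inj₁ star₃)
near-view (star (suc (suc (suc (suc _))))) = inj₂ (inj₂ refl)
near-view (dstar 0 0) = inj₂ (inj₁ path₄)
near-view (dstar 0 (suc _)) = inj₂ (inj₂ refl)
near-view (dstar (suc _) _) = inj₂ (inj₂ refl)
near-view (tri 0) = inj₂ (inj₂ refl)
near-view (tri 1) = inj₂ (inj₁ paw)
near-view (tri (suc (suc _))) = inj₂ (inj₂ refl)
near-view four = inj₁ refl

edge#≤1 : ∀ s → edge# s ≤ 1
edge#≤1 (star 0) = z≤n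
edge#≤1 (star 1) = ≤-refl
edge#≤1 (star (suc (suc _))) = z≤n
edge#≤1 (dstar _ _) = z≤n
edge#≤1 (tri _) = z≤n
edge#≤1 four = z≤n

path#≤1 : ∀ s → path# s ≤ 1
path#≤1 (star 0) = z≤n
path#≤1 (star 1) = z≤n
path#≤1 (star 2) = ≤-refl
path#≤1 (star (suc (suc (suc _)))) = z≤n
path#≤1 (dstar _ _) = z≤n
path#≤1 (tri _) = z≤n
path#≤1 four = z≤n

four#≤near# : ∀ s → four# s ≤ near# s
four#≤near# (star _) = z≤n
four#≤near# (dstar _ _) = z≤n
four#≤near# (tri _) = z≤n
four#≤near# four = ≤-refl

-- Closing a 4-cycle adds no vertex to a component, so the source already has exactly 4 vertices.
four-step : ∀ {ρ} → ρ ⟶ four → weight near# ρ ≢ 0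
four-step (regular close-path) ()
four-step close-tri ()
four-step new-chord ()

safe-step : ∀ {σ ρ τ s} → Safe σ → σ ↭ ρ ++ τ → ρ ⟶ s → Loose (s ∷ τ)
safe-step {σ} {ρ} {τ} {s} (safe n0 e1 p1) p st
  rewrite weight-split near# ρ p | weight-split edge# ρ p | weight-split path# ρ p with near-view s
... | inj₁ refl = contradiction (m+n≡0⇒m≡0 _ n0) (four-step st)
... | inj₂ (inj₁ q) = near q ↭-refl
  (safe (m+n≡0⇒n≡0 (weight near# ρ) n0) (≤-trans (m≤n+m _ _) e1) (≤-trans (m≤n+m _ _) p1))
... | inj₂ (inj₂ q) = loose
  (cong₂ _+_ q (m+n≡0⇒n≡0 (weight near# ρ) n0))
  (+-mono-≤ (edge#≤1 s) (≤-trans (m≤n+m _ _) e1))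
  (+-mono-≤ (path#≤1 s) (≤-trans (m≤n+m _ _) p1))

-- This inequality dictates the constants. Two single edges join to a path on 4 vertices, hence 1
-- for an edge against 2 for a near shape; an isolated vertex makes a near shape from a path on 3
-- vertices or a triangle, both of potential 0, hence 2 for an isolated vertex.
potential-step : ∀ {ρ s} → ρ ⟶ s → potential s ≤ weight potential ρ
potential-step (regular (iso-star {0})) = s≤s z≤n
potential-step (regular (iso-star {1})) = z≤n
potential-step (regular (iso-star {2})) = ≤-refl
potential-step (regular (iso-star {suc (suc (suc _))})) = z≤n
potential-step (regular (iso-dstarˡ)) = z≤n
potential-step (regular (iso-dstarʳ {0})) = z≤n
potential-step (regular (iso-dstarʳ {suc _})) = z≤n
potential-step (regular (iso-tri {0})) = ≤-refl
potential-step (regular (iso-tri {suc _})) = z≤n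
potential-step (regular (star-star {0} {0})) = ≤-refl
potential-step (regular (star-star {0} {suc _})) = z≤n
potential-step (regular (star-star {suc _})) = z≤n
potential-step (regular (close-star {0})) = z≤n
potential-step (regular (close-star {1})) = ≤-refl
potential-step (regular (close-star {suc (suc _)})) = z≤n
potential-step (regular (close-dstarˡ {0})) = ≤-refl
potential-step (regular (close-dstarˡ {suc _})) = z≤n
potential-step (regular (close-dstarʳ {0})) = ≤-refl
potential-step (regular (close-dstarʳ {suc _})) = z≤n
potential-step (regular close-path) = ≤-refl
potential-step (iso-leaf {0}) = ≤-refl
potential-step (iso-leaf {suc _}) = z≤n
potential-step close-tri = ≤-refl
potential-step new-chord = ≤-refl

potential-advance : ∀ {σ ρ τ s} → σ ↭ ρ ++ τ → ρ ⟶ s → weight potential (s ∷ τ) ≤ weight potential σ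
potential-advance {ρ = ρ} {τ} p st rewrite weight-split potential ρ p = +-monoˡ-≤ (weight potential τ) (potential-step st)

find-isolated : ∀ σ {k} → weight isolated# σ ≡ suc k → ∃ λ τ → σ ↭ star 0 ∷ τ
find-isolated σ eq with weight-positive isolated# σ eq
... | star 0 , τ , p , _ = τ , p

find-edge : ∀ σ {k} → weight edge# σ ≡ suc k → ∃ λ τ → σ ↭ star 1 ∷ τ
find-edge σ eq with weight-positive edge# σ eq
... | star 1 , τ , p , _ = τ , p

find-path : ∀ σ {k} → weight path# σ ≡ suc k → ∃ λ τ → σ ↭ star 2 ∷ τ
find-path σ eq with weight-positive path# σ eq
... | star 2 , τ , p , _ = τ , p

Reply : (P : List Shape → Set) → Graph n → Set
Reply P G = ∃ λ σ → Realised G σ × P σ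

-- An isolated vertex lifts the near component to 5 vertices. If there is none, that component
-- counts 2 and at most one edge counts 1, which gives the threshold 3.
absorb : ∀ {G : Graph n} {σ s τ} → G ⊨ σ → Near s → σ ↭ s ∷ τ → Safe τ →
  weight potential σ ≤ 3 ⊎ Reply Safe G
absorb {σ = σ} {s} {τ} m q p (safe n0 e1 p1) with weight isolated# τ in i
... | zero = inj₁ (begin
    weight potential σ ≡⟨ weight-↭ potential p ⟩
    potential s + weight potential τ ≡⟨ cong₂ _+_ (potential-near q) (weight-potential τ) ⟩
    2 + (2 * weight isolated# τ + (weight edge# τ + 2 * weight near# τ))
      ≡⟨ cong₂ (λ i k → 2 + (2 * i + (weight edge# τ + 2 * k))) i n0 ⟩
    2 + (weight edge# τ + 0) ≡⟨ cong (2 +_) (+-identityʳ _) ⟩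
    2 + weight edge# τ ≤⟨ +-monoʳ-≤ 2 e1 ⟩
    3 ∎)
  where
  open ≤-Reasoning
  potential-near : ∀ {s} → Near s → potential s ≡ 2
  potential-near star₃ = refl
  potential-near path₄ = refl
  potential-near paw = refl
... | suc _ with τ′ , p′ ← find-isolated τ i
    rewrite weight-↭ near# p′ | weight-↭ edge# p′ | weight-↭ path# p′ = inj₂ (grown q)
  where
  rest : ∀ {s} → σ ↭ s ∷ τ → σ ↭ star 0 ∷ s ∷ τ′
  rest p = ↭-trans p (↭-trans (↭-prep _ p′) (↭-swap _ _ ↭-refl))
  grown : Near s → Reply Safe _
  grown star₃ = -, realise m (rest p) iso-star , safe n0 e1 p1
  grown path₄ = -, realise m (rest p) iso-dstarˡ , safe n0 e1 p1
  grown paw = -, realise m (rest p) iso-tri , safe n0 e1 p1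

-- In order of preference: an edge and a path are joined on 5 vertices, a path is closed to a
-- triangle, an edge is lengthened to a path, two isolated vertices become an edge. None of these
-- makes a component on 4 vertices, and when none applies the potential comes from at most two edges
-- or one isolated vertex.
tighten : ∀ {G : Graph n} {σ} → G ⊨ σ → weight near# σ ≡ 0 → weight edge# σ ≤ 2 → weight path# σ ≤ 2 →
  weight potential σ ≤ 3 ⊎ Reply Safe G
tighten {G = G} {σ} m n0 e2 p2 = go _ _ _ refl refl refl
  where
  small : ∀ {i e} → weight isolated# σ ≡ i → weight edge# σ ≡ e → 2 * i + (e + 0) ≤ 3 → weight potential σ ≤ 3
  small refl refl ≤3 = ≤-trans (≤-reflexive (≡.trans (weight-potential σ)
    (cong (λ k → 2 * weight isolated# σ + (weight edge# σ + 2 * k)) n0))) ≤3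

  reply : ∀ {ρ s τ} → σ ↭ ρ ++ τ → ρ ⇒ s →
    (weight near# (ρ ++ τ) ≡ 0 → weight edge# (ρ ++ τ) ≤ 2 → weight path# (ρ ++ τ) ≤ 2 → Safe (s ∷ τ)) →
    weight potential σ ≤ 3 ⊎ Reply Safe G
  reply p st f = inj₂ (-, realise m p st ,
    f (≡.trans (sym (weight-↭ near# p)) n0)
      (≤-trans (≤-reflexive (sym (weight-↭ edge# p))) e2) (≤-trans (≤-reflexive (sym (weight-↭ path# p))) p2))

  go : ∀ i e p → weight isolated# σ ≡ i → weight edge# σ ≡ e → weight path# σ ≡ p →
    weight potential σ ≤ 3 ⊎ Reply Safe G
  go _ (suc _) (suc _) _ e p with τ , q ← find-edge σ e
    with τ′ , q′ ← find-path τ (≡.trans (sym (weight-↭ path# q)) p) =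
    reply (↭-trans q (↭-prep _ q′)) star-star λ n0 e2 p2 → safe n0 (≤-pred e2) (≤-pred p2)
  go _ zero (suc _) _ e p with τ , q ← find-path σ p =
    reply q close-star λ n0 e2 p2 → safe n0 (≤-trans (≤-reflexive (≡.trans (sym (weight-↭ edge# q)) e)) z≤n) (≤-pred p2)
  go (suc _) (suc _) zero i e p with τ , q ← find-edge σ e
    with τ′ , q′ ← find-isolated τ (≡.trans (sym (weight-↭ isolated# q)) i) =
    reply (↭-trans q (↭-trans (↭-prep _ q′) (↭-swap _ _ ↭-refl))) iso-star λ n0 e2 p2 →
      safe n0 (≤-pred e2) (s≤s (≤-reflexive (≡.trans (sym (≡.trans (weight-↭ path# q) (weight-↭ path# q′))) p)))
  go zero (suc _) zero i e p =
    inj₁ (small i refl (≤-trans (≤-reflexive (+-identityʳ _)) (≤-trans e2 (n≤1+n 2))))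
  go (suc (suc _)) zero zero i e p with τ , q ← find-isolated σ i
    with τ′ , q′ ← find-isolated τ (suc-injective (≡.trans (sym (weight-↭ isolated# q)) i)) =
    reply (↭-trans q (↭-prep _ q′)) iso-star λ n0 e2 p2 →
      safe n0 (s≤s (≤-reflexive (≡.trans (sym (≡.trans (weight-↭ edge# q) (weight-↭ edge# q′))) e)))
        (≤-trans (≤-reflexive (≡.trans (sym (≡.trans (weight-↭ path# q) (weight-↭ path# q′))) p)) z≤n)
  go 0 zero zero i e p = inj₁ (small i e z≤n)
  go 1 zero zero i e p = inj₁ (small i e (s≤s (s≤s z≤n)))

shortener-reply : ∀ {G : Graph n} {σ} → G ⊨ σ → Loose σ → weight potential σ ≤ 3 ⊎ Reply Safe G
shortener-reply m (near q p s) = absorb m q p s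
shortener-reply m (loose n0 e2 p2) = tighten m n0 e2 p2

2four≤potential : ∀ σ → 2 * weight four# σ ≤ weight potential σ
2four≤potential σ = ≤-trans (*-monoʳ-≤ 2 (weight-mono four#≤near# σ)) (≤-trans
  (≤-trans (m≤n+m _ (weight edge# σ)) (m≤n+m _ (2 * weight isolated# σ)))
  (≤-reflexive (sym (weight-potential σ))))

low-bound : ∀ {G : Graph n} {σ} → G ⊨ σ → weight potential σ ≤ 3 → length G ≤ n + 2
low-bound {n} {σ = σ} m low = ≤-trans (upper-bound m) (+-monoʳ-≤ n (*-monoʳ-≤ 2 four≤1))
  where
  four≤1 : weight four# σ ≤ 1
  four≤1 = ≤-pred (*-cancelˡ-< 2 (weight four# σ) 2 (s≤s (≤-trans (2four≤potential σ) low)))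

safe-bound : ∀ {G : Graph n} {σ} → G ⊨ σ → weight four# σ ≡ 0 → length G ≤ n
safe-bound {n} {σ = σ} m eq = ≤-trans (upper-bound m)
  (≤-reflexive (≡.trans (cong (λ k → n + 2 * k) eq) (+-identityʳ n)))

four-absent : ∀ σ → weight near# σ ≡ 0 → weight four# σ ≡ 0
four-absent σ n0 = n≤0⇒n≡0 (≤-trans (weight-mono four#≤near# σ) (≤-reflexive n0))

loose-four : ∀ {σ} → Loose σ → weight four# σ ≡ 0
loose-four {σ} (loose n0 _ _) = four-absent σ n0
loose-four (near {τ = τ} q p (safe n0 _ _)) = ≡.trans (weight-↭ four# p) (cong₂ _+_ (near-four q) (four-absent τ n0))
  where
  near-four : ∀ {s} → Near s → four# s ≡ 0
  near-four star₃ = refl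
  near-four path₄ = refl
  near-four paw = refl

-- The potential never rises again, so at most one 4-cycle component can ever be present, and
-- arbitrary moves of Shortener are good enough.
endgame : ∀ k p {G : Graph n} {σ} → G ⊨ σ → weight potential σ ≤ 3 → length G + k ≡ n + 2 → AtMost k p G
endgame {n} k p {G} {σ} m low len = play k p len
  where
  after : ∀ {u v} → Legal G u v → ∃ λ τ → (u , v) ∷ G ⊨ τ × weight potential τ ≤ 3
  after l with advance p st m′ ← classify l m = -, m′ , ≤-trans (potential-advance p st) low

  play : ∀ k p → length G + k ≡ n + 2 → AtMost k p G
  -- With no budget left, `n + 2` edges are present, and one more would break `low-bound`.
  play zero p len = over λ u v l → let _ , m′ , low′ = after l in
    1+n≰n (≤-trans (low-bound m′ low′) (≤-reflexive (≡.trans (sym len) (+-identityʳ _))))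
  play (suc k) prolonger len = pmove λ u v l → let _ , m′ , low′ = after l in
    endgame k shortener m′ low′ (≡.trans (sym (+-suc _ k)) len)
  play (suc k) shortener len with saturated? G
  ... | inj₂ sat = over sat
  ... | inj₁ (u , v , l) = let _ , m′ , low′ = after l in
    smove u v l (endgame k prolonger m′ low′ (≡.trans (sym (+-suc _ k)) len))

remaining : ∀ k {m n} → m ≤ n → m + k ≡ n + 2 → ∃ λ k′ → k ≡ suc k′
remaining (suc k) _ _ = k , refl
remaining zero {m} {n} m≤n eq = contradiction
  (≤-trans (≤-reflexive (≡.trans (+-comm 2 n) (≡.trans (sym eq) (+-identityʳ m)))) m≤n) (1+n≰n ∘ <⇒≤)

mutual
  -- `k` is what remains of the budget `n + 2`. Neither a `Safe` nor a `Loose` position has a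
  -- 4-cycle, so at most `n` edges are present and the budget cannot run out before `endgame` takes
  -- over.
  shortener-waits : ∀ k {G : Graph n} {σ} → G ⊨ σ → Safe σ → length G + k ≡ n + 2 → AtMost k prolonger G
  shortener-waits k {σ = σ} m s len with remaining k (safe-bound m (four-absent σ (Safe.near≡0 s))) len
  ... | k′ , refl = pmove λ u v l → let advance p st m′ = classify l m in
    shortener-plays k′ m′ (safe-step s p st) (≡.trans (sym (+-suc _ k′)) len)

  shortener-plays : ∀ k {G : Graph n} {σ} → G ⊨ σ → Loose σ → length G + k ≡ n + 2 → AtMost k shortener G
  shortener-plays k m s len with shortener-reply m s
  ... | inj₁ low = endgame k shortener m low len
  ... | inj₂ (_ , realised l m′ , s′) with remaining k (safe-bound m (loose-four s)) len
  ... | k′ , refl = smove _ _ l (shortener-waits k′ m′ s′ (≡.trans (sym (+-suc _ k′)) len))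

-- Prolonger's strategy

nontrivial# large# : Shape → ℕ
nontrivial# (star 0) = 0
nontrivial# (star (suc _)) = 1
nontrivial# (dstar _ _) = 1
nontrivial# (tri _) = 0
nontrivial# four = 0
large# (star (suc (suc (suc _)))) = 1
large# (star _) = 0
large# (dstar 0 0) = 0
large# (dstar _ _) = 1
large# (tri _) = 0
large# four = 0

tree-split : ∀ s → tree# s ≡ isolated# s + nontrivial# s
tree-split (star 0) = refl
tree-split (star 1) = refl
tree-split (star (suc (suc _))) = refl
tree-split (dstar _ _) = refl
tree-split (tri _) = refl
tree-split four = refl

weight-tree : ∀ σ → weight tree# σ ≡ weight isolated# σ + weight nontrivial# σ
weight-tree [] = refl
weight-tree (s ∷ σ) rewrite weight-tree σ | tree-split s = interchange +-commutativeSemigroup (isolated# s) _ _ _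

-- `large#` counts the trees that are not paths on at most 4 vertices. A path on 3 or 4 vertices can
-- be closed in one step; a single edge cannot, and `edge-reply` deals with it.
record Settled (σ : List Shape) : Set where
  constructor settled
  field
    tree≤1 : weight nontrivial# σ ≤ 1
    large≡0 : weight large# σ ≡ 0

-- The large trees that arise when an isolated vertex is attached to a path on 3 or 4 vertices; each
-- can be closed to a triangle with leaves at once.
data Closable : Shape → Set where
  star₃ : Closable (star 3)
  fork : Closable (dstar 1 0)
  fork′ : Closable (dstar 0 1)

data Open (σ : List Shape) : Set where
  quiet : Settled σ → Open σ
  extra-edge : ∀ {τ} → σ ↭ star 1 ∷ τ → Settled τ → Open σ
  closable : ∀ {s τ} → Closable s → σ ↭ s ∷ τ → weight nontrivial# τ ≡ 0 → weight large# τ ≡ 0 → Open σ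

-- With at most one nontrivial tree around, the opponent has no two of them to join. What is left is
-- to make a new edge, to extend or close the one tree, or to play on components that already have a
-- cycle.
settled-step : ∀ {σ ρ τ s} → Settled σ → σ ↭ ρ ++ τ → ρ ⟶ s → Open (s ∷ τ)
settled-step {ρ = ρ} {τ} (settled t≤1 l≡0) p st =
  go st (subst (_≤ 1) (weight-split nontrivial# ρ p) t≤1)
    (≡.trans (sym (weight-split large# ρ p)) l≡0)
  where
  go : ∀ {ρ s} → ρ ⟶ s → weight nontrivial# ρ + weight nontrivial# τ ≤ 1 →
    weight large# ρ + weight large# τ ≡ 0 → Open (s ∷ τ)
  -- The constructors and indices missing below would start from a tree counted by `large#`, which
  -- `l` excludes.
  go (regular (iso-star {0})) t l = extra-edge ↭-refl (settled t l)
  go (regular (iso-star {1})) t l = quiet (settled t l)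
  go (regular (iso-star {2})) t l = closable star₃ ↭-refl (n≤0⇒n≡0 (≤-pred t)) l
  go (regular (iso-dstarˡ {0} {0})) t l = closable fork ↭-refl (n≤0⇒n≡0 (≤-pred t)) l
  go (regular (iso-dstarʳ {0} {0})) t l = closable fork′ ↭-refl (n≤0⇒n≡0 (≤-pred t)) l
  go (regular iso-tri) t l = quiet (settled t l)
  go (regular star-star) (s≤s ()) l
  go (regular (close-star {0})) t l = quiet (settled (<⇒≤ t) l)
  go (regular close-dstarˡ) t l = quiet (settled (<⇒≤ t) (m+n≡0⇒n≡0 _ l))
  go (regular close-dstarʳ) t l = quiet (settled (<⇒≤ t) (m+n≡0⇒n≡0 _ l))
  go (regular close-path) t l = quiet (settled (<⇒≤ t) l)
  go (iso-leaf {0}) t l = quiet (settled t l)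
  go close-tri t l = quiet (settled t l)
  go new-chord t l = quiet (settled t l)

data Small : Shape → Set where
  edge : Small (star 1)
  path₃ : Small (star 2)
  path₄ : Small (dstar 0 0)

find-small : ∀ σ {k} → weight nontrivial# σ ≡ suc k → weight large# σ ≡ 0 →
  ∃ λ s → ∃ λ τ → σ ↭ s ∷ τ × Small s × weight nontrivial# τ ≡ k × weight large# τ ≡ 0
find-small σ eq l with weight-positive nontrivial# σ eq
... | s , τ , p , _ , pos with ≡.trans (sym (weight-↭ nontrivial# p)) eq | ≡.trans (sym (weight-↭ large# p)) l
find-small σ eq l | star 1 , τ , p , _ | t | l′ = -, τ , p , edge , suc-injective t , l′
find-small σ eq l | star 2 , τ , p , _ | t | l′ = -, τ , p , path₃ , suc-injective t , l′
find-small σ eq l | dstar 0 0 , τ , p , _ | t | l′ = -, τ , p , path₄ , suc-injective t , l′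

-- A single edge cannot be closed, so it is joined to a second edge, kept while another small tree
-- is closed, or lengthened by an isolated vertex. If nothing of this is possible, the edge is the
-- only tree.
edge-reply : ∀ {G : Graph n} {σ τ} → G ⊨ σ → σ ↭ star 1 ∷ τ → Settled τ → weight tree# σ ≤ 1 ⊎ Reply Settled G
edge-reply {G = G} {σ} {τ} m p (settled t≤1 l≡0) = go _ _ refl refl
  where
  go : ∀ i t → weight isolated# τ ≡ i → weight nontrivial# τ ≡ t → weight tree# σ ≤ 1 ⊎ Reply Settled G
  go 0 0 i t = inj₁ (≤-reflexive (≡.trans (weight-↭ tree# p) (cong suc (≡.trans (weight-tree τ) (cong₂ _+_ i t)))))
  go (suc _) 0 i t with τ′ , q ← find-isolated τ i =
    inj₂ (-, realise m (↭-trans p (↭-trans (↭-prep _ q) (↭-swap _ _ ↭-refl))) iso-star ,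
      settled (s≤s (≤-reflexive (≡.trans (sym (weight-↭ nontrivial# q)) t)))
        (≡.trans (sym (weight-↭ large# q)) l≡0))
  go _ (suc k) _ t with find-small τ t l≡0
  ... | _ , τ′ , q , s , tτ , lτ = inj₂ (close s q)
    where
    t′≤1 : suc (weight nontrivial# τ′) ≤ 1
    t′≤1 = ≤-trans (≤-reflexive (≡.trans (cong suc tτ) (sym t))) t≤1
    front : ∀ {s} → τ ↭ s ∷ τ′ → σ ↭ s ∷ star 1 ∷ τ′
    front q = ↭-trans p (↭-trans (↭-prep _ q) (↭-swap _ _ ↭-refl))
    close : ∀ {s} → Small s → τ ↭ s ∷ τ′ → Reply Settled G
    close edge q = -, realise m (front q) star-star , settled t′≤1 lτ
    -- The other tree is closed here and in the next case, and the edge stays as the one nontrivial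
    -- tree.
    close path₃ q = -, realise m (front q) close-star , settled t′≤1 lτ
    close path₄ q = -, realise m (front q) close-path , settled t′≤1 lτ

prolonger-reply : ∀ {G : Graph n} {σ} → G ⊨ σ → Open σ → weight tree# σ ≤ 1 ⊎ Reply Settled G
prolonger-reply {G = G} {σ} m (quiet (settled t≤1 l≡0)) = go _ _ refl refl
  where
  go : ∀ i t → weight isolated# σ ≡ i → weight nontrivial# σ ≡ t → weight tree# σ ≤ 1 ⊎ Reply Settled G
  go 0 0 i t = inj₁ (≤-trans (≤-reflexive (≡.trans (weight-tree σ) (cong₂ _+_ i t))) z≤n)
  go 1 0 i t = inj₁ (≤-reflexive (≡.trans (weight-tree σ) (cong₂ _+_ i t)))
  go (suc (suc _)) 0 i t with τ , q ← find-isolated σ i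
    with τ′ , q′ ← find-isolated τ (suc-injective (≡.trans (sym (weight-↭ isolated# q)) i))
    with p ← ↭-trans q (↭-prep _ q′) =
    inj₂ (-, realise m p iso-star , settled (s≤s (≤-reflexive (≡.trans (sym (weight-↭ nontrivial# p)) t)))
      (≡.trans (sym (weight-↭ large# p)) l≡0))
  go _ (suc k) _ t with find-small σ t l≡0
  ... | _ , τ , p , s , tτ , lτ = close s p
    where
    t′≤1 : weight nontrivial# τ ≤ 1
    t′≤1 = ≤-trans (≤-reflexive tτ) (≤-trans (n≤1+n k) (≤-trans (≤-reflexive (sym t)) t≤1))
    close : ∀ {s} → Small s → σ ↭ s ∷ τ → weight tree# σ ≤ 1 ⊎ Reply Settled G
    close edge p = edge-reply m p (settled t′≤1 lτ)
    close path₃ p = inj₂ (-, realise m p close-star , settled t′≤1 lτ)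
    close path₄ p = inj₂ (-, realise m p close-path , settled t′≤1 lτ)
prolonger-reply m (extra-edge p s) = edge-reply m p s
prolonger-reply m (closable c p t l) = inj₂ (close c p)
  where
  close : ∀ {s} → Closable s → _ ↭ s ∷ _ → Reply Settled _
  close star₃ p = -, realise m p close-star , settled (≤-trans (≤-reflexive t) z≤n) l
  close fork p = -, realise m p close-dstarˡ , settled (≤-trans (≤-reflexive t) z≤n) l
  close fork′ p = -, realise m p close-dstarʳ , settled (≤-trans (≤-reflexive t) z≤n) l

-- By `lower-bound`, at most one tree means at least `n - 1` edges, so Prolonger has a reply as long
-- as his target is not reached.
few-trees : ∀ {k} {G : Graph n} {σ} → G ⊨ σ → weight tree# σ ≤ 1 → ¬ (length G + suc k < n)
few-trees {n} {k} {G} {σ} m t≤1 len = <-irrefl refl (begin-strict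
  n ≤⟨ lower-bound m ⟩
  length G + weight tree# σ ≤⟨ +-monoʳ-≤ (length G) t≤1 ⟩
  length G + 1 ≤⟨ +-monoʳ-≤ (length G) (s≤s z≤n) ⟩
  length G + suc k <⟨ len ⟩
  n ∎)
  where open ≤-Reasoning

mutual
  -- The inequality is strict because the target is `n - 1` edges in all, not `n`.
  prolonger-waits : ∀ k {G : Graph n} {σ} → G ⊨ σ → Settled σ → length G + k < n → AtLeast k shortener G
  prolonger-waits zero m s len = done
  prolonger-waits (suc k) m s len with prolonger-reply m (quiet s)
  ... | inj₁ t≤1 = ⊥-elim (few-trees m t≤1 len)
  -- The legal move that shows the game is not over is the one Prolonger would make himself;
  -- Shortener's actual move is then arbitrary.
  ... | inj₂ (_ , realised l _ , _) = smove _ _ l λ u v l → let advance p st m′ = classify l m in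
    prolonger-plays k m′ (settled-step s p st) (≤-trans (s≤s (≤-reflexive (sym (+-suc _ k)))) len)

  prolonger-plays : ∀ k {G : Graph n} {σ} → G ⊨ σ → Open σ → length G + k < n → AtLeast k prolonger G
  prolonger-plays zero m s len = done
  prolonger-plays (suc k) m s len with prolonger-reply m s
  ... | inj₁ t≤1 = ⊥-elim (few-trees m t≤1 len)
  ... | inj₂ (_ , realised l m′ , s′) = pmove _ _ l (prolonger-waits k m′ s′ (≤-trans (s≤s (≤-reflexive (sym (+-suc _ k)))) len))

-- The two bounds combined

at-least : ∀ n p → AtLeast {suc n} n p []
at-least n p = play p
  where
  s : Settled (initial (suc n))
  s = settled (initial-≤ nontrivial# refl (suc n)) (initial-weight large# refl (suc n))
  play : ∀ p → AtLeast {suc n} n p []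
  play prolonger = prolonger-plays n (start (suc n)) (quiet s) ≤-refl
  play shortener = prolonger-waits n (start (suc n)) s ≤-refl

at-most : ∀ n p → AtMost {n} (n + 2) p []
at-most n prolonger = shortener-waits (n + 2) (start n)
  (safe (initial-weight near# refl n) (initial-≤ edge# refl n) (initial-≤ path# refl n)) refl
at-most n shortener = shortener-plays (n + 2) (start n)
  (loose (initial-weight near# refl n) (initial-≤ edge# refl n) (initial-≤ path# refl n)) refl

theorem3 : ∀ (n : ℕ) → 0 < n → ∀ (first : Player) →
    Σ ℕ λ g → IsGameSatNumber n first g × (n ∸ 1 ≤ g) × (g ≤ n + 2)
theorem3 (suc n) _ first = subst (λ k → ∃ λ g → IsGameSatNumber (suc n) first g × n ≤ g × g ≤ k) (+-suc n 2)
  -- On `suc n` vertices the bounds are `n` and `n + 3`, hence the gap 3.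
  (game-value 3 n (at-least n first) (subst (λ k → AtMost {suc n} k first []) (sym (+-suc n 2)) (at-most (suc n) first)))
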